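{- Let $j,n$ be integers with $2\leq j\leq\frac{n}{2}$ and let $e=n+1$. Then $$\lambda(C_n^{\{0,2\}})=\begin{cases}4&\text{if }e\leq8;\\5&\text{if }e=9;\\ \left\lceil\frac{ -1+\sqrt{8e+17}}{2}\right\rceil&\text{if }e\geq10\text{ and }\left\lceil\frac{ -1+\sqrt{8e+17}}{2}\right\rceil\text{ is odd};\\ \left\lceil\sqrt{2e-2}\right\rceil&\text{otherwise,}\end{cases}$$ and if $j\geq3$, then $$\lambda(C_n^{\{0,j\}})=\begin{cases}4&\text{if }e\leq6;\\ \left\lceil\frac{ -1+\sqrt{8e+1}}{2}\right\rceil&\text{if }e\geq7\text{ and }\left\lceil\frac{ -1+\sqrt{8e+1}}{2}\right\rceil\text{ is odd};\\ \left\lceil\sqrt{2e-2}\right\rceil&\text{otherwise.}\end{cases}$$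
   Context: For a graph $G$, the edge-distinguishing chromatic number $\lambda(G)$ is the minimum positive integer $k$ for which there is a vertex coloring $c:V(G)\to\{1,\dotsc,k\}$ such that the edge labels $\{c(u),c(v)\}$ are distinct for distinct edges $uv$. For $2\leq j\leq n/2$, $C_n^{\{0,j\}}$ is the cycle $w_0w_1\dotsb w_{n-1}w_0$ on $n$ vertices together with one chord $w_0w_j$; it has $n+1$ edges. -}

module Defs where

open import Data.Nat using (ℕ; zero; suc; _+_; _*_; _∸_; _≤_; _≤ᵇ_)
open import Data.Fin using (Fin; toℕ)
open import Data.Product using (_×_; Σ)
open import Data.Sum using (_⊎_)
open import Data.Bool using (Bool; if_then_else_)
open import Relation.Binary.PropositionalEquality using (_≡_)

-- A (loopless, undirected) graph on vertex set Fin n is given by a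
-- symmetric adjacency relation; edges are unordered pairs {u,v} with Adj u v.

SamePair : {A : Set} → A → A → A → A → Set
SamePair a b x y = (a ≡ x × b ≡ y) ⊎ (a ≡ y × b ≡ x)

IsEdgeDistinguishing : {n k : ℕ} → (Fin n → Fin n → Set) → (Fin n → Fin k) → Set
IsEdgeDistinguishing {n} Adj c =
  (u v x y : Fin n) → Adj u v → Adj x y →
  SamePair (c u) (c v) (c x) (c y) → SamePair u v x y

HasEDColouring : {n : ℕ} → (Fin n → Fin n → Set) → ℕ → Set
HasEDColouring {n} Adj k = Σ (Fin n → Fin k) (IsEdgeDistinguishing Adj)

EdgeDistChromaticNumber≡ : {n : ℕ} → (Fin n → Fin n → Set) → ℕ → Set
EdgeDistChromaticNumber≡ Adj k =
  1 ≤ k × HasEDColouring Adj k × ((k' : ℕ) → 1 ≤ k' → HasEDColouring Adj k' → k ≤ k')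

CycleStep : (n : ℕ) → Fin n → Fin n → Set
CycleStep n u v = (toℕ v ≡ suc (toℕ u)) ⊎ (toℕ u ≡ n ∸ 1 × toℕ v ≡ 0)

ChordStep : (j : ℕ) → {n : ℕ} → Fin n → Fin n → Set
ChordStep j u v = toℕ u ≡ 0 × toℕ v ≡ j

CnChord : (n j : ℕ) → Fin n → Fin n → Set
CnChord n j u v =
  CycleStep n u v ⊎ CycleStep n v u ⊎ ChordStep j u v ⊎ ChordStep j v u

leastFrom : (ℕ → Bool) → ℕ → ℕ → ℕ
leastFrom p k zero = k
leastFrom p k (suc f) = if p k then k else leastFrom p (suc k) f

-- ⌈√m⌉ = least k ∈ ℕ with m ≤ k²  (k = m always works, so the search is exhaustive)
ceilSqrt : ℕ → ℕ
ceilSqrt m = leastFrom (λ k → m ≤ᵇ k * k) 0 m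

-- ⌈(-1 + √m)/2⌉ = least k ∈ ℕ with m ≤ (2k+1)²  (valid for m ≥ 1)
ceilHalfSqrtMinus1 : ℕ → ℕ
ceilHalfSqrtMinus1 m = leastFrom (λ k → m ≤ᵇ (2 * k + 1) * (2 * k + 1)) 0 m

Odd : ℕ → Set
Odd m = Σ ℕ (λ t → m ≡ 2 * t + 1)

{-# OPTIONS --safe #-}

-- A colouring is the same thing as a closed walk of length n in the complete graph with loops on the
-- k colours, repeating no edge, together with a further edge joining its points at distance j.
--
-- For the lower bounds, count darts (oriented edges) by the colour at their origin: a colour x
-- meets at most k + 1 of them, and their number has the parity of the number of chord ends coloured x.
-- If k is even this makes every colour other than those of the chord ends lose a dart; if k is odd
-- and j = 2, both ends of the chord lose one, and then some third colour loses two.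
--
-- For the upper bounds, the walk splits at the ends 0 and b of the chord into two parts. Two new
-- colours p, q can be added by splicing at 0 a closed detour that uses all new edges (all but {p, q}
-- when k is even). A detour is short compared with the longer part as soon as k is large, so this
-- induction reduces all pairs of lengths to finitely many tabulated ones.
module Submission where

open import Defs
open import Data.Bool using (true; false; T)
open import Data.Fin using (Fin; toℕ; fromℕ<)
open import Data.Fin.Properties using (toℕ-fromℕ<; toℕ-injective; toℕ<n)
open import Data.List using (List; []; _∷_; _++_; length; replicate; reverse; drop; applyUpTo; applyDownFrom)
open import Data.List.Properties using (++-assoc; unfold-reverse; reverse-++; length-reverse; length-++)
open import Data.List.Membership.DecPropositional using (_∈?_)
open import Data.List.Membership.Propositional using (_∉_)
open import Data.List.Membership.Propositional.Properties using (∈-applyUpTo⁺; ∈-applyDownFrom⁻)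
open import Data.List.Relation.Binary.Disjoint.Propositional using (Disjoint)
open import Data.List.Relation.Binary.Permutation.Propositional using (prep; ↭-sym; ↭⇒↭ₛ)
open import Data.List.Relation.Binary.Permutation.Propositional.Properties using (↭-reverse; All-resp-↭)
open import Data.List.Relation.Binary.Permutation.Setoid.Properties using (Unique-resp-↭)
open import Data.List.Relation.Unary.All as All using (All; []; _∷_; all?)
import Data.List.Relation.Unary.All.Properties as All
open import Data.List.Relation.Unary.AllPairs using ([]; _∷_)
open import Data.List.Relation.Unary.Any using (Any; any?; satisfied)
open import Data.List.Relation.Unary.Unique.DecPropositional using (unique?)
open import Data.List.Relation.Unary.Unique.Propositional using (Unique)
import Data.List.Relation.Unary.Unique.Propositional.Properties as Unique
open import Data.Nat
open import Data.Nat.DivMod using (_mod_; m%n<n; m<n⇒m%n≡m; n%n≡0)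
open import Data.Nat.ListAction using (sum)
open import Data.Nat.Properties
open import Data.Nat.Tactic.RingSolver using (solve-∀)
open import Data.Parity using (0ℙ; 1ℙ; _⁻¹)
import Data.Parity as ℙ
import Data.Parity.Properties as ℙₚ
open import Data.Product using (_×_; _,_; ∃; ∃-syntax; proj₁; proj₂)
open import Data.Product.Properties using (≡-dec)
open import Data.Sum using (_⊎_; inj₁; inj₂)
open import Function using (_∘_; case_of_)
open import Relation.Binary.PropositionalEquality
open import Relation.Nullary using (¬_; ¬?; Dec; yes; no; does; contradiction)
open import Relation.Nullary.Decidable using (_×-dec_; _→-dec_; from-yes; from-no; True; toWitness)

-- Parity and finite sums

parity-m+m : ∀ m → parity (m + m) ≡ 0ℙ
parity-m+m m = trans (ℙₚ.+-homo-+ m m) (ℙₚ.p+p≡0ℙ (parity m))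

∑ : ℕ → (ℕ → ℕ) → ℕ
∑ n f = sum (applyDownFrom f n)

module _ {f h : ℕ → ℕ} where

  ∑-cong : ∀ n → (∀ {t} → t < n → f t ≡ h t) → ∑ n f ≡ ∑ n h
  ∑-cong zero    eq = refl
  ∑-cong (suc n) eq = cong₂ _+_ (eq ≤-refl) (∑-cong n (eq ∘ m<n⇒m<1+n))

  ∑-mono : ∀ n → (∀ {t} → t < n → f t ≤ h t) → ∑ n f ≤ ∑ n h
  ∑-mono zero    le = z≤n
  ∑-mono (suc n) le = +-mono-≤ (le ≤-refl) (∑-mono n (le ∘ m<n⇒m<1+n))

  ∑-+ : ∀ n → ∑ n (λ t → f t + h t) ≡ ∑ n f + ∑ n h
  ∑-+ zero    = refl
  ∑-+ (suc n) = trans (cong (f n + h n +_) (∑-+ n)) (interchange (f n) (h n) (∑ n f) (∑ n h))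
    where
    interchange : ∀ a b c d → a + b + (c + d) ≡ a + c + (b + d)
    interchange = solve-∀

  parity-∑ : ∀ n → (∀ {t} → t < n → parity (f t) ≡ parity (h t)) →
             parity (∑ n f) ≡ parity (∑ n h)
  parity-∑ zero    eq = refl
  parity-∑ (suc n) eq
    rewrite ℙₚ.+-homo-+ (f n) (∑ n f) | ℙₚ.+-homo-+ (h n) (∑ n h)
    = cong₂ ℙ._+_ (eq ≤-refl) (parity-∑ n (eq ∘ m<n⇒m<1+n))

∑-const : ∀ n c → ∑ n (λ _ → c) ≡ n * c
∑-const zero    c = refl
∑-const (suc n) c = cong (c +_) (∑-const n c)

∑-*ˡ : ∀ n c f → ∑ n (λ t → c * f t) ≡ c * ∑ n f
∑-*ˡ zero    c f = sym (*-zeroʳ c)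
∑-*ˡ (suc n) c f = trans (cong (c * f n +_) (∑-*ˡ n c f)) (sym (*-distribˡ-+ c (f n) (∑ n f)))

∑-swap : ∀ m n (f : ℕ → ℕ → ℕ) →
         ∑ m (λ x → ∑ n (f x)) ≡ ∑ n (λ y → ∑ m (λ x → f x y))
∑-swap zero    n f = sym (trans (∑-const n 0) (*-zeroʳ n))
∑-swap (suc m) n f = trans (cong (∑ n (f m) +_) (∑-swap m n f)) (sym (∑-+ n))

-- Both sides sum f over 0, ..., n. When f n = f 0, as on a closed walk, this becomes invariance
-- under rotation.
∑-shift : ∀ n f → ∑ n (f ∘ suc) + f 0 ≡ ∑ n f + f n
∑-shift zero    f = refl
∑-shift (suc n) f = begin
  f (suc n) + ∑ n (f ∘ suc) + f 0    ≡⟨ +-assoc (f (suc n)) _ _ ⟩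
  f (suc n) + (∑ n (f ∘ suc) + f 0)  ≡⟨ cong (f (suc n) +_) (∑-shift n f) ⟩
  f (suc n) + (∑ n f + f n)          ≡⟨ rotate (f (suc n)) (∑ n f) (f n) ⟩
  f n + ∑ n f + f (suc n)            ∎
  where
  open ≡-Reasoning
  rotate : ∀ a b c → a + (b + c) ≡ c + b + a
  rotate = solve-∀

-- Used for the darts of one colour pair: distinct labels leave at most one nonzero term, so a bound
-- on each term bounds the sum.
∑-sparse : ∀ n f b → (∀ {t} → t < n → f t ≤ b) →
           (∀ {s t} → s < n → t < n → 0 < f s → 0 < f t → s ≡ t) → ∑ n f ≤ b
∑-sparse zero    f b f≤b once = z≤n
∑-sparse (suc n) f b f≤b once with f n in eq
... | zero  = ∑-sparse n f b (f≤b ∘ m<n⇒m<1+n)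
                (λ s<n t<n → once (m<n⇒m<1+n s<n) (m<n⇒m<1+n t<n))
... | suc v = subst (_≤ b) (trans eq (sym (trans (cong (suc v +_) vanish) (+-identityʳ _)))) (f≤b ≤-refl)
  where
  zero-below : ∀ {t} → t < n → f t ≡ 0
  zero-below {t} t<n with f t in eq′
  ... | zero  = refl
  ... | suc w = contradiction
    (once (m<n⇒m<1+n t<n) ≤-refl (subst (0 <_) (sym eq′) z<s) (subst (0 <_) (sym eq) z<s)) (<⇒≢ t<n)
  vanish : ∑ n f ≡ 0
  vanish = trans (∑-cong n zero-below) (trans (∑-const n 0) (*-zeroʳ n))

term≤∑ : ∀ n f {t} → t < n → f t ≤ ∑ n f
term≤∑ (suc n) f {t} t<1+n with m<1+n⇒m<n∨m≡n t<1+n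
... | inj₁ t<n  = ≤-trans (term≤∑ n f t<n) (m≤n+m _ (f n))
... | inj₂ refl = m≤m+n (f t) _

δ : ℕ → ℕ → ℕ
δ x y with x ≟ y
... | yes _ = 1
... | no _  = 0

δ-refl : ∀ x → δ x x ≡ 1
δ-refl x with x ≟ x
... | yes _  = refl
... | no x≢x = contradiction refl x≢x

δ-≢ : ∀ {x y} → x ≢ y → δ x y ≡ 0
δ-≢ {x} {y} x≢y with x ≟ y
... | yes x≡y = contradiction x≡y x≢y
... | no _    = refl

∑-δ : ∀ k {s} → s < k → ∑ k (δ s) ≡ 1
∑-δ (suc k) {s} s<1+k with m<1+n⇒m<n∨m≡n s<1+k
... | inj₁ s<k  rewrite δ-≢ (<⇒≢ s<k) = ∑-δ k s<k
... | inj₂ refl rewrite δ-refl s =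
  cong suc (trans (∑-cong s (λ t<s → δ-≢ (≢-sym (<⇒≢ t<s)))) (trans (∑-const s 0) (*-zeroʳ s)))

-- Edge labels and cyclic colourings

-- Normal form of an unordered pair, larger end first: equal labels become equal pairs, and the
-- first component bounds both ends.
edge : ℕ → ℕ → ℕ × ℕ
edge x y = x ⊔ y , x ⊓ y

edge-comm : ∀ x y → edge x y ≡ edge y x
edge-comm x y = cong₂ _,_ (⊔-comm x y) (⊓-comm x y)

-- Edge 0 is the chord, and edge t + 1 is the t-th edge of the cycle.
source : (ℕ → ℕ) → ℕ → ℕ
source g zero    = g 0
source g (suc t) = g t

target : ℕ → (ℕ → ℕ) → ℕ → ℕ
target j g zero    = g j
target j g (suc t) = g (suc t)

label : ℕ → (ℕ → ℕ) → ℕ → ℕ × ℕ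
label j g t = edge (source g t) (target j g t)

-- Vertices are read along ℕ, with `closed` identifying position n with position 0. The n + 1 labels
-- carry the indices 0, ..., n.
record CyclicColouring (n j k : ℕ) : Set where
  field
    colour   : ℕ → ℕ
    bounded  : ∀ t → colour t < k
    closed   : colour n ≡ colour 0
    distinct : ∀ {s t} → s ≤ n → t ≤ n → label j colour s ≡ label j colour t → s ≡ t

-- Lower bounds by counting darts

module Counting {n j k} (C : CyclicColouring n j k) where
  open CyclicColouring C renaming (colour to g)

  a b : ℕ
  a = g 0
  b = g j

  S E : ℕ → ℕ
  S = source g
  E = target j g

  S<k : ∀ t → S t < k
  S<k zero    = bounded 0
  S<k (suc t) = bounded t

  E<k : ∀ t → E t < k
  E<k zero    = bounded j
  E<k (suc t) = bounded (suc t)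

  -- The number of orientations of edge t that lead from colour x to colour y. `M` collects them in
  -- a symmetric matrix, and `R x` counts all darts with origin coloured x, which is the sum of row
  -- x by `∑-M`.
  dart : ℕ → ℕ → ℕ → ℕ
  dart x y t = δ (S t) x * δ (E t) y + δ (S t) y * δ (E t) x

  M : ℕ → ℕ → ℕ
  M x y = ∑ (suc n) (dart x y)

  R : ℕ → ℕ
  R x = ∑ (suc n) (λ t → δ (S t) x + δ (E t) x)

  dart>0⇒edge : ∀ x y t → 0 < dart x y t → edge (S t) (E t) ≡ edge x y
  dart>0⇒edge x y t pos with S t ≟ x | E t ≟ y | S t ≟ y | E t ≟ x
  ... | yes p | yes q | _     | _     = cong₂ edge p q
  ... | _     | _     | yes p | yes q = trans (cong₂ edge p q) (edge-comm y x)
  ... | yes _ | no _  | yes _ | no _  = contradiction pos λ ()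
  ... | yes _ | no _  | no _  | _     = contradiction pos λ ()
  ... | no _  | _     | yes _ | no _  = contradiction pos λ ()
  ... | no _  | _     | no _  | _     = contradiction pos λ ()

  dart≤ : ∀ x y t → dart x y t ≤ 1 + δ x y
  dart≤ x y t with S t ≟ x | E t ≟ y | S t ≟ y | E t ≟ x | x ≟ y
  ... | yes p | _     | yes q | _     | no x≢y = contradiction (trans (sym p) q) x≢y
  ... | yes _ | yes _ | no _  | _     | no _   = ≤-refl
  ... | yes _ | no _  | no _  | _     | no _   = z≤n
  ... | no _  | _     | yes _ | yes _ | no _   = ≤-refl
  ... | no _  | _     | yes _ | no _  | no _   = z≤n
  ... | no _  | _     | no _  | _     | no _   = z≤n
  ... | yes _ | yes _ | yes _ | yes _ | yes _  = ≤-refl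
  ... | yes _ | yes _ | yes _ | no _  | yes _  = s≤s z≤n
  ... | yes _ | yes _ | no _  | _     | yes _  = s≤s z≤n
  ... | yes _ | no _  | yes _ | yes _ | yes _  = s≤s z≤n
  ... | yes _ | no _  | yes _ | no _  | yes _  = z≤n
  ... | yes _ | no _  | no _  | _     | yes _  = z≤n
  ... | no _  | _     | yes _ | yes _ | yes _  = s≤s z≤n
  ... | no _  | _     | yes _ | no _  | yes _  = z≤n
  ... | no _  | _     | no _  | _     | yes _  = z≤n

  -- A loop counts as two darts, whence the capacity 1 + δ x y.
  M≤ : ∀ x y → M x y ≤ 1 + δ x y
  M≤ x y = ∑-sparse (suc n) (dart x y) (1 + δ x y) (λ {t} _ → dart≤ x y t)
    λ { {s} {t} (s≤s s≤n) (s≤s t≤n) ps pt →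
        distinct s≤n t≤n (trans (dart>0⇒edge x y s ps) (sym (dart>0⇒edge x y t pt))) }

  M-comm : ∀ x y → M x y ≡ M y x
  M-comm x y = ∑-cong (suc n) λ {t} _ → +-comm (δ (S t) x * δ (E t) y) _

  parity-M-diag : ∀ x → parity (M x x) ≡ 0ℙ
  parity-M-diag x = trans
    (parity-∑ {dart x x} {λ _ → 0} (suc n) (λ {t} _ → parity-m+m (δ (S t) x * δ (E t) x)))
    (cong parity (trans (∑-const (suc n) 0) (*-zeroʳ (suc n))))

  ∑-M : ∀ x → ∑ k (M x) ≡ R x
  ∑-M x = begin
    ∑ k (λ y → ∑ (suc n) (dart x y))  ≡⟨ ∑-swap k (suc n) (dart x) ⟩
    ∑ (suc n) (λ t → ∑ k (λ y → dart x y t))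
      ≡⟨ ∑-cong (suc n) (λ {t} _ → row t) ⟩
    R x                               ∎
    where
    open ≡-Reasoning
    row : ∀ t → ∑ k (λ y → dart x y t) ≡ δ (S t) x + δ (E t) x
    row t = begin
      ∑ k (λ y → δ (S t) x * δ (E t) y + δ (S t) y * δ (E t) x)
        ≡⟨ ∑-+ k ⟩
      ∑ k (λ y → δ (S t) x * δ (E t) y) + ∑ k (λ y → δ (S t) y * δ (E t) x)
        ≡⟨ cong₂ _+_ (∑-*ˡ k (δ (S t) x) (δ (E t)))
             (trans (∑-cong k (λ {y} _ → *-comm (δ (S t) y) _)) (∑-*ˡ k (δ (E t) x) (δ (S t)))) ⟩
      δ (S t) x * ∑ k (δ (E t)) + δ (E t) x * ∑ k (δ (S t))
        ≡⟨ cong₂ _+_ (trans (cong (δ (S t) x *_) (∑-δ k (E<k t))) (*-identityʳ (δ (S t) x)))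
                     (trans (cong (δ (E t) x *_) (∑-δ k (S<k t))) (*-identityʳ (δ (E t) x))) ⟩
      δ (S t) x + δ (E t) x ∎

  ∑-R : ∑ k R ≡ 2 * suc n
  ∑-R = begin
    ∑ k R ≡⟨ ∑-swap k (suc n) _ ⟩
    ∑ (suc n) (λ t → ∑ k (λ x → δ (S t) x + δ (E t) x))
      ≡⟨ ∑-cong (suc n) (λ {t} _ → trans (∑-+ k) (cong₂ _+_ (∑-δ k (S<k t)) (∑-δ k (E<k t)))) ⟩
    ∑ (suc n) (λ _ → 2) ≡⟨ trans (∑-const (suc n) 2) (*-comm (suc n) 2) ⟩
    2 * suc n ∎
    where open ≡-Reasoning

  -- Every position on the cycle is the source of one cycle edge and the target of another, so the
  -- cycle contributes an even number and only the chord ends are left.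
  parity-R : ∀ x → parity (R x) ≡ parity (δ a x + δ b x)
  parity-R x = begin
    parity (R x)
      ≡⟨ cong parity (∑-shift′ n (λ t → δ (S t) x + δ (E t) x)) ⟩
    parity (δ a x + δ b x + ∑ n (λ t → δ (g t) x + δ (g (suc t)) x))
      ≡⟨ ℙₚ.+-homo-+ (δ a x + δ b x) _ ⟩
    parity (δ a x + δ b x) ℙ.+ parity (∑ n (λ t → δ (g t) x + δ (g (suc t)) x))
      ≡⟨ cong (parity (δ a x + δ b x) ℙ.+_) even ⟩
    parity (δ a x + δ b x) ℙ.+ 0ℙ
      ≡⟨ ℙₚ.+-identityʳ _ ⟩
    parity (δ a x + δ b x) ∎
    where
    open ≡-Reasoning
    h : ℕ → ℕ
    h t = δ (g t) x
    ∑-shift′ : ∀ n f → ∑ (suc n) f ≡ f 0 + ∑ n (f ∘ suc)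
    ∑-shift′ n f = trans (+-comm (f n) _) (trans (sym (∑-shift n f)) (+-comm _ (f 0)))
    rotation : ∑ n (h ∘ suc) ≡ ∑ n h
    rotation = +-cancelʳ-≡ (h 0) _ _
      (trans (∑-shift n h) (cong (∑ n h +_) (cong (λ y → δ y x) closed)))
    even : parity (∑ n (λ t → h t + h (suc t))) ≡ 0ℙ
    even = begin
      parity (∑ n (λ t → h t + h (suc t)))  ≡⟨ cong parity (∑-+ n) ⟩
      parity (∑ n h + ∑ n (h ∘ suc))        ≡⟨ cong (λ z → parity (∑ n h + z)) rotation ⟩
      parity (∑ n h + ∑ n h)                ≡⟨ parity-m+m (∑ n h) ⟩
      0ℙ                                    ∎

  ∑-cap : ∀ {x} → x < k → ∑ k (λ y → 1 + δ x y) ≡ suc k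
  ∑-cap {x} x<k = begin
    ∑ k (λ y → 1 + δ x y)        ≡⟨ ∑-+ k ⟩
    ∑ k (λ _ → 1) + ∑ k (δ x)    ≡⟨ cong₂ _+_ (trans (∑-const k 1) (*-identityʳ k)) (∑-δ k x<k) ⟩
    k + 1                        ≡⟨ +-comm k 1 ⟩
    suc k                        ∎
    where open ≡-Reasoning

  R≤ : ∀ {x} → x < k → R x ≤ suc k
  R≤ {x} x<k = subst₂ _≤_ (∑-M x) (∑-cap x<k) (∑-mono k (λ {y} _ → M≤ x y))

  -- If x is not the colour of a chord end, `R x` is even while k + 1 is odd, so a dart is lost. The
  -- δ terms give it back to the chord colours.
  R≤-even : parity k ≡ 0ℙ → ∀ {x} → x < k → R x ≤ k + (δ a x + δ b x)
  R≤-even pk {x} x<k with δ a x + δ b x in eq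
  ... | suc _ = ≤-trans (R≤ x<k) (≤-trans (≤-reflexive (+-comm 1 k)) (+-monoʳ-≤ k (s≤s z≤n)))
  ... | zero  = subst (R x ≤_) (sym (+-identityʳ k)) (≤-pred (≤∧≢⇒< (R≤ x<k) R≢))
    where
    R≢ : R x ≢ suc k
    R≢ eq′ = case trans (sym (cong parity eq′)) (trans (parity-R x) (cong parity eq)) of
      λ p → contradiction (trans (sym (ℙₚ.suc-homo-⁻¹ k)) (cong _⁻¹ p)) λ q → case trans (sym pk) q of λ ()

  edges≤ : 2 * suc n ≤ k * suc k
  edges≤ = subst₂ _≤_ ∑-R (∑-const k (suc k)) (∑-mono k R≤)

  edges≤-even : parity k ≡ 0ℙ → 2 * suc n ≤ k * k + 2
  edges≤-even pk = subst₂ _≤_ ∑-R total (∑-mono k (R≤-even pk))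
    where
    total : ∑ k (λ x → k + (δ a x + δ b x)) ≡ k * k + 2
    total = trans (∑-+ k) (cong₂ _+_ (∑-const k k)
      (trans (∑-+ k) (cong₂ _+_ (∑-δ k (bounded 0)) (∑-δ k (bounded j)))))

  -- The vertices 0, 1, 2 form a triangle, so a and b differ, and each has odd `R` below the even
  -- bound k + 1. The parity of row a then produces a third colour y that misses a and loses two
  -- darts. Together four darts are lost.
  edges≤-odd : parity k ≡ 1ℙ → 2 ≤ n → j ≡ 2 → 2 * suc n + 4 ≤ k * suc k
  edges≤-odd pk 2≤n refl = subst₂ _≤_ total (∑-const k (suc k)) (∑-mono k refined)
    where
    1≤n : 1 ≤ n
    1≤n = ≤-trans (s≤s z≤n) 2≤n

    a≢b : a ≢ b
    a≢b a≡b = case distinct 1≤n 2≤n (trans (edge-comm a (g 1)) (cong (edge (g 1)) a≡b)) of λ ()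

    parity-k+1 : parity (suc k) ≡ 0ℙ
    parity-k+1 = ℙₚ.⁻¹-injective (trans (ℙₚ.suc-homo-⁻¹ k) pk)

    parity-R-a : parity (R a) ≡ 1ℙ
    parity-R-a = trans (parity-R a) (cong parity (cong₂ _+_ (δ-refl a) (δ-≢ (≢-sym a≢b))))

    parity-R-b : parity (R b) ≡ 1ℙ
    parity-R-b = trans (parity-R b) (cong parity (cong₂ _+_ (δ-≢ a≢b) (δ-refl b)))

    M-ab : 0 < M a b
    M-ab = ≤-trans (subst (0 <_) (sym dart-chord) z<s) (term≤∑ (suc n) (dart a b) z<s)
      where
      dart-chord : dart a b 0 ≡ suc (δ a b * δ b a)
      dart-chord rewrite δ-refl a | δ-refl b = refl

    -- Row a of M has odd sum, while the row of capacities 1 + δ a y has even sum k + 1.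
    discrepancy : ∃[ y ] (y < k × parity (M a y) ≢ parity (1 + δ a y))
    discrepancy with anyUpTo? (λ y → ¬? (parity (M a y) ℙₚ.≟ parity (1 + δ a y))) k
    ... | yes found = found
    ... | no  none  = case trans (sym parity-R-a) (trans (cong parity (sym (∑-M a)))
                        (trans (parity-∑ k agree) (trans (cong parity (∑-cap (bounded 0))) parity-k+1))) of λ ()
      where
      agree : ∀ {y} → y < k → parity (M a y) ≡ parity (1 + δ a y)
      agree {y} y<k with parity (M a y) ℙₚ.≟ parity (1 + δ a y)
      ... | yes same = same
      ... | no  diff = contradiction (y , y<k , diff) none

    y : ℕ
    y = proj₁ discrepancy

    y<k : y < k
    y<k = proj₁ (proj₂ discrepancy)

    a≢y : a ≢ y
    -- On the diagonal there is no discrepancy: `M a a` and the capacity 2 are both even.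
    a≢y a≡y = proj₂ (proj₂ discrepancy) (subst (λ z → parity (M a z) ≡ parity (1 + δ a z)) a≡y
      (trans (parity-M-diag a) (sym (cong (parity ∘ suc) (δ-refl a)))))

    M-ay : M a y ≡ 0
    M-ay with M a y | M≤ a y | proj₂ (proj₂ discrepancy)
    ... | zero        | _ | _    = refl
    ... | suc zero    | _ | diff = contradiction (cong (parity ∘ suc) (sym (δ-≢ a≢y))) diff
    ... | suc (suc m) | le | _   = contradiction (subst (2 + m ≤_) (cong suc (δ-≢ a≢y)) le) λ { (s≤s ()) }

    b≢y : b ≢ y
    b≢y b≡y = <⇒≢ M-ab (sym (trans (cong (M a) b≡y) M-ay))

    R-y : 2 + R y ≤ suc k
    R-y = s≤s (≤∧≢⇒< (≤-pred R-y<) λ eq →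
      case trans (sym (trans (parity-R y) (cong parity (cong₂ _+_ (δ-≢ a≢y) (δ-≢ b≢y)))))
                 (trans (cong parity eq) pk) of λ ())
      where
      column : ∀ {z} → z < k → M y z + δ a z ≤ 1 + δ y z
      column {z} z<k with a ≟ z
      ... | no _     = subst (_≤ 1 + δ y z) (sym (+-identityʳ _)) (M≤ y z)
      ... | yes refl = subst (λ m → m + 1 ≤ 1 + δ y z) (sym (trans (M-comm y z) M-ay)) (s≤s z≤n)
      R-y< : suc (R y) ≤ suc k
      R-y< = subst₂ _≤_
        (trans (∑-+ k) (trans (cong₂ _+_ (∑-M y) (∑-δ k (bounded 0))) (+-comm (R y) 1)))
        (∑-cap y<k) (∑-mono k column)

    R≤k : ∀ {x} → x < k → parity (R x) ≡ 1ℙ → R x + 1 ≤ suc k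
    R≤k {x} x<k odd = subst (_≤ suc k) (+-comm 1 (R x)) (≤∧≢⇒< (R≤ x<k) λ eq →
      case trans (sym odd) (trans (cong parity eq) parity-k+1) of λ ())

    -- As a, b and y are pairwise distinct, their losses 1, 1 and 2 fit into one inequality, to be
    -- summed over all x.
    refined : ∀ {x} → x < k → R x + (δ a x + δ b x + 2 * δ y x) ≤ suc k
    refined {x} x<k with a ≟ x | b ≟ x | y ≟ x
    ... | yes a≡x | yes b≡x | _       = contradiction (trans a≡x (sym b≡x)) a≢b
    ... | yes a≡x | no _    | yes y≡x = contradiction (trans a≡x (sym y≡x)) a≢y
    ... | no _    | yes b≡x | yes y≡x = contradiction (trans b≡x (sym y≡x)) b≢y
    ... | yes a≡x | no _    | no _    = R≤k x<k (subst (λ z → parity (R z) ≡ 1ℙ) a≡x parity-R-a)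
    ... | no _    | yes b≡x | no _    = R≤k x<k (subst (λ z → parity (R z) ≡ 1ℙ) b≡x parity-R-b)
    ... | no _    | no _    | yes y≡x = subst (λ z → R z + 2 ≤ suc k) y≡x (subst (_≤ suc k) (+-comm 2 (R y)) R-y)
    ... | no _    | no _    | no _    = subst (_≤ suc k) (sym (+-identityʳ (R x))) (R≤ x<k)

    total : ∑ k (λ x → R x + (δ a x + δ b x + 2 * δ y x)) ≡ 2 * suc n + 4
    total = begin
      ∑ k (λ x → R x + (δ a x + δ b x + 2 * δ y x))
        ≡⟨ trans (∑-+ k) (cong (∑ k R +_) (∑-+ k)) ⟩
      ∑ k R + (∑ k (λ x → δ a x + δ b x) + ∑ k (λ x → 2 * δ y x))
        ≡⟨ cong₂ _+_ ∑-R (cong₂ _+_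
             (trans (∑-+ k) (cong₂ _+_ (∑-δ k (bounded 0)) (∑-δ k (bounded 2))))
             (trans (∑-*ˡ k 2 (δ y)) (cong (2 *_) (∑-δ k y<k)))) ⟩
      2 * suc n + 4 ∎
      where open ≡-Reasoning

-- Walks and drawings

walk : ℕ → List ℕ → ℕ → List (ℕ × ℕ)
walk a []       b = edge a b ∷ []
walk a (x ∷ xs) b = edge a x ∷ walk x xs b

walk-++ : ∀ a xs y ys b → walk a (xs ++ y ∷ ys) b ≡ walk a xs y ++ walk y ys b
walk-++ a []       y ys b = refl
walk-++ a (x ∷ xs) y ys b = cong (edge a x ∷_) (walk-++ x xs y ys b)

walk-reverse : ∀ a xs b → walk b (reverse xs) a ≡ reverse (walk a xs b)
walk-reverse a []       b = cong (_∷ []) (edge-comm b a)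
walk-reverse a (x ∷ xs) b = begin
  walk b (reverse (x ∷ xs)) a                ≡⟨ cong (λ zs → walk b zs a) (unfold-reverse x xs) ⟩
  walk b (reverse xs ++ x ∷ []) a            ≡⟨ walk-++ b (reverse xs) x [] a ⟩
  walk b (reverse xs) x ++ edge x a ∷ []     ≡⟨ cong₂ _++_ (walk-reverse x xs b) (cong (_∷ []) (edge-comm x a)) ⟩
  reverse (walk x xs b) ++ edge a x ∷ []     ≡⟨ unfold-reverse (edge a x) (walk x xs b) ⟨
  reverse (edge a x ∷ walk x xs b)           ∎
  where open ≡-Reasoning

walk-< : ∀ {k a b xs} → a < k → All (_< k) xs → b < k → All ((_< k) ∘ proj₁) (walk a xs b)
walk-< a<k []           b<k = ⊔-lub a<k b<k ∷ []
walk-< a<k (x<k ∷ xs<k) b<k = ⊔-lub a<k x<k ∷ walk-< x<k xs<k b<k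

-- The closed walk 0, xs, b, ys, 0 in the complete graph with loops on {0, …, k - 1},
-- with edge {0, b} standing for the chord.
IsDrawing : (b k i l : ℕ) → List ℕ × List ℕ → Set
IsDrawing b k i l (xs , ys) =
  b < k × suc (length xs) ≡ i × suc (length ys) ≡ l × All (_< k) xs × All (_< k) ys ×
  Unique (edge 0 b ∷ walk 0 xs b ++ walk b ys 0)

isDrawing? : ∀ b k i l e → Dec (IsDrawing b k i l e)
isDrawing? b k i l (xs , ys) =
  b <? k ×-dec suc (length xs) ≟ i ×-dec suc (length ys) ≟ l ×-dec
  all? (_<? k) xs ×-dec all? (_<? k) ys ×-dec unique? (≡-dec _≟_ _≟_) _

Drawing : (b k i l : ℕ) → Set
Drawing b k i l = ∃ (IsDrawing b k i l)

-- Traversing the closed walk backwards exchanges its two parts, so the part to be cut may be taken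
-- to be the longer one.
swap : ∀ {b k i l} → Drawing b k i l → Drawing b k l i
swap {b} ((xs , ys) , b<k , refl , refl , xs<k , ys<k , unique) =
  (reverse ys , reverse xs) , b<k , cong suc (length-reverse ys) , cong suc (length-reverse xs) ,
  All-resp-↭ (↭-sym (↭-reverse ys)) ys<k , All-resp-↭ (↭-sym (↭-reverse xs)) xs<k ,
  subst (λ es → Unique (edge 0 b ∷ es)) reversed
    (Unique-resp-↭ (setoid _) (↭⇒↭ₛ (prep (edge 0 b) (↭-sym (↭-reverse _)))) unique)
  where
  reversed : reverse (walk 0 xs b ++ walk b ys 0) ≡ walk 0 (reverse ys) b ++ walk b (reverse xs) 0
  reversed = trans (reverse-++ (walk 0 xs b) (walk b ys 0))
    (sym (cong₂ _++_ (walk-reverse b ys 0) (walk-reverse 0 xs b)))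

widen : ∀ {b k i l} → Drawing b k i l → Drawing b (2 + k) i l
widen (e , b<k , p , q , xs<k , ys<k , unique) =
  e , m<n⇒m<1+n (m<n⇒m<1+n b<k) , p , q , All.map up xs<k , All.map up ys<k , unique
  where
  up : ∀ {x k} → x < k → x < 2 + k
  up = m<n⇒m<1+n ∘ m<n⇒m<1+n

-- Detours through two new colours

-- Since the larger end comes first, `fresh` says that every edge meets one of the new colours k and
-- k + 1, and so occurs in no drawing on k colours.
record Detour (k c : ℕ) : Set where
  field
    via     : List ℕ
    length≡ : suc (length via) ≡ c
    via<    : All (_< 2 + k) via
    unique  : Unique (walk 0 via 0)
    fresh   : All ((k ≤_) ∘ proj₁) (walk 0 via 0)

extend : ∀ {b k c i l} → Detour k c → Drawing b k i l → Drawing b (2 + k) i (l + c)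
extend {b} {k} D d@((xs , ys) , b<k , refl , refl , xs<k , ys<k , unique) =
  let (_ , b<2+k , _ , _ , xs<2+k , ys<2+k , _) = widen d in
  (xs , ys ++ 0 ∷ via) , b<2+k , refl ,
  trans (cong suc (length-++ ys)) (cong (suc (length ys) +_) length≡) , xs<2+k ,
  All.++⁺ ys<2+k (z<s ∷ via<) ,
  subst (λ es → Unique (edge 0 b ∷ es)) split (Unique.++⁺ unique D.unique disjoint)
  where
  module D = Detour D
  open D using (via; length≡; via<; fresh)
  split : (walk 0 xs b ++ walk b ys 0) ++ walk 0 via 0 ≡ walk 0 xs b ++ walk b (ys ++ 0 ∷ via) 0
  split = trans (++-assoc (walk 0 xs b) _ _) (cong (walk 0 xs b ++_) (sym (walk-++ b ys 0 via 0)))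
  0<k : 0 < k
  0<k = ≤-trans z<s b<k
  old< : All ((_< k) ∘ proj₁) (edge 0 b ∷ walk 0 xs b ++ walk b ys 0)
  old< = b<k ∷ All.++⁺ (walk-< 0<k xs<k b<k) (walk-< b<k ys<k 0<k)
  disjoint : Disjoint (edge 0 b ∷ walk 0 xs b ++ walk b ys 0) (walk 0 via 0)
  disjoint (old , new) = <⇒≱ (All.lookup old< old) (All.lookup fresh new)

edge-≥ : ∀ {x y} → y ≤ x → edge x y ≡ (x , y)
edge-≥ y≤x = cong₂ _,_ (m≥n⇒m⊔n≡m y≤x) (m≥n⇒m⊓n≡n y≤x)

edge-≤ : ∀ {x y} → x ≤ y → edge x y ≡ (y , x)
edge-≤ x≤y = cong₂ _,_ (m≤n⇒m⊔n≡n x≤y) (m≤n⇒m⊓n≡m x≤y)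

module _ (p q : ℕ) where

  -- With p and q the new colours, this is the interior of a walk from p to 0. It runs through the
  -- 4-cycles p, 2s, q, 2s - 1 for s = r, ..., 1, which use all edges from p and q to 1, ..., 2r,
  -- and ends with {p, 0}.
  zigzag : ℕ → List ℕ
  zigzag zero    = []
  zigzag (suc r) = 2 + r * 2 ∷ q ∷ 1 + r * 2 ∷ p ∷ zigzag r

  -- In normal form the old colours stand second and never increase along the list, so uniqueness
  -- reduces to comparing second components, and p with q where these agree.
  zigzagEdges : ℕ → List (ℕ × ℕ)
  zigzagEdges zero    = (p , 0) ∷ []
  zigzagEdges (suc r) = (p , 2 + r * 2) ∷ (q , 2 + r * 2) ∷ (q , 1 + r * 2) ∷ (p , 1 + r * 2) ∷ zigzagEdges r

  walk-zigzag : ∀ r → r * 2 ≤ p → r * 2 ≤ q → walk p (zigzag r) 0 ≡ zigzagEdges r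
  walk-zigzag zero    _  _  = cong (_∷ []) (edge-≥ z≤n)
  walk-zigzag (suc r) ≤p ≤q =
    cong₂ _∷_ (edge-≥ ≤p) (cong₂ _∷_ (edge-≤ ≤q) (cong₂ _∷_ (edge-≥ (<⇒≤ ≤q)) (cong₂ _∷_ (edge-≤ (<⇒≤ ≤p))
      (walk-zigzag r (<⇒≤ (<⇒≤ ≤p)) (<⇒≤ (<⇒≤ ≤q))))))

  length-zigzag : ∀ r → length (zigzag r) ≡ r * 4
  length-zigzag zero    = refl
  length-zigzag (suc r) = cong (4 +_) (length-zigzag r)

  zigzag-< : ∀ {m} r → r * 2 < m → p < m → q < m → All (_< m) (zigzag r)
  zigzag-< zero    _   _   _   = []
  zigzag-< (suc r) 2r< p<m q<m = 2r< ∷ q<m ∷ <⇒≤ 2r< ∷ p<m ∷ zigzag-< r (<⇒≤ (<⇒≤ 2r<)) p<m q<m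

  zigzagEdges-low : ∀ r → All ((_≤ r * 2) ∘ proj₂) (zigzagEdges r)
  zigzagEdges-low zero    = z≤n ∷ []
  zigzagEdges-low (suc r) = ≤-refl ∷ ≤-refl ∷ n≤1+n _ ∷ n≤1+n _ ∷ All.map (m≤n⇒m≤1+n ∘ m≤n⇒m≤1+n) (zigzagEdges-low r)

  zigzagEdges-high : ∀ {k} r → k ≤ p → k ≤ q → All ((k ≤_) ∘ proj₁) (zigzagEdges r)
  zigzagEdges-high zero    k≤p k≤q = k≤p ∷ []
  zigzagEdges-high (suc r) k≤p k≤q = k≤p ∷ k≤q ∷ k≤q ∷ k≤p ∷ zigzagEdges-high r k≤p k≤q

  above-zigzag : ∀ {x y} r → r * 2 < y → All ((x , y) ≢_) (zigzagEdges r)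
  above-zigzag r 2r<y = All.map (λ { y≤2r refl → <⇒≱ 2r<y y≤2r }) (zigzagEdges-low r)

  zigzagEdges-q0 : ∀ r → q ≢ p → All ((q , 0) ≢_) (zigzagEdges r)
  zigzagEdges-q0 zero    q≢p = q≢p ∘ cong proj₁ ∷ []
  zigzagEdges-q0 (suc r) q≢p = (λ ()) ∷ (λ ()) ∷ (λ ()) ∷ (λ ()) ∷ zigzagEdges-q0 r q≢p

  zigzagEdges-unique : ∀ r → q ≢ p → Unique (zigzagEdges r)
  zigzagEdges-unique zero    q≢p = [] ∷ []
  zigzagEdges-unique (suc r) q≢p =
    (q≢p ∘ sym ∘ cong proj₁ ∷ 1+n≢n ∘ cong proj₂ ∷ 1+n≢n ∘ cong proj₂ ∷ above-zigzag r (n≤1+n _)) ∷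
    (1+n≢n ∘ cong proj₂ ∷ 1+n≢n ∘ cong proj₂ ∷ above-zigzag r (n≤1+n _)) ∷
    (q≢p ∘ cong proj₁ ∷ above-zigzag r ≤-refl) ∷
    above-zigzag r ≤-refl ∷
    zigzagEdges-unique r q≢p

-- For k = 2r + 1 all 2k + 3 new edges are used: {0, q}, the two loops, {p, q}, and the zigzag over
-- the old colours 1, ..., 2r that returns by {p, 0}.
detour-odd : ∀ r → Detour (1 + r * 2) (5 + r * 4)
detour-odd r = record
  { via     = q ∷ q ∷ p ∷ p ∷ zigzag p q r
  ; length≡ = cong (5 +_) (length-zigzag p q r)
  ; via<    = q< ∷ q< ∷ p< ∷ p< ∷ zigzag-< p q r (<⇒≤ (<⇒≤ ≤-refl)) p< q<
  ; unique  = subst Unique (sym edges)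
      (((λ ()) ∷ (λ ()) ∷ (λ ()) ∷ zigzagEdges-q0 p q r 1+n≢n) ∷
       (1+n≢n ∘ cong proj₂ ∷ 1+n≢n ∘ cong proj₂ ∷ above-zigzag p q r (n≤1+n _)) ∷
       (1+n≢n ∘ cong proj₁ ∷ above-zigzag p q r ≤-refl) ∷
       above-zigzag p q r ≤-refl ∷
       zigzagEdges-unique p q r 1+n≢n)
  ; fresh   = subst (All _) (sym edges)
      (n≤1+n p ∷ n≤1+n p ∷ n≤1+n p ∷ ≤-refl ∷ zigzagEdges-high p q r ≤-refl (n≤1+n p))
  }
  where
  p q : ℕ
  p = 1 + r * 2
  q = suc p
  p< : p < 2 + p
  p< = n≤1+n _
  q< : q < 2 + p
  q< = ≤-refl
  edges : walk 0 (q ∷ q ∷ p ∷ p ∷ zigzag p q r) 0 ≡ (q , 0) ∷ (q , q) ∷ (q , p) ∷ (p , p) ∷ zigzagEdges p q r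
  edges = cong ((q , 0) ∷_) (cong₂ _∷_ (edge-≥ ≤-refl) (cong₂ _∷_ (edge-≥ (n≤1+n p)) (cong₂ _∷_ (edge-≥ ≤-refl)
    (walk-zigzag p q r (n≤1+n _) (<⇒≤ (n≤1+n _))))))

-- For k = 2r + 2 each new colour has k + 1 new edges besides its loop, an odd number, so a closed
-- walk cannot use them all. The path q, x, p through the last old colour replaces {p, q}, leaving
-- 2k + 2 edges.
detour-even : ∀ r → Detour (2 + r * 2) (6 + r * 4)
detour-even r = record
  { via     = q ∷ q ∷ x ∷ p ∷ p ∷ zigzag p q r
  ; length≡ = cong (6 +_) (length-zigzag p q r)
  ; via<    = q< ∷ q< ∷ <⇒≤ p< ∷ p< ∷ p< ∷ zigzag-< p q r (<⇒≤ (<⇒≤ (<⇒≤ ≤-refl))) p< q<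
  ; unique  = subst Unique (sym edges)
      (((λ ()) ∷ (λ ()) ∷ (λ ()) ∷ (λ ()) ∷ zigzagEdges-q0 p q r 1+n≢n) ∷
       (m+1+n≢n 1 ∘ cong proj₂ ∷ 1+n≢n ∘ cong proj₁ ∷ 1+n≢n ∘ cong proj₁ ∷ above-zigzag p q r (<⇒≤ (n≤1+n _))) ∷
       (1+n≢n ∘ cong proj₁ ∷ 1+n≢n ∘ cong proj₁ ∷ above-zigzag p q r ≤-refl) ∷
       (1+n≢n ∘ sym ∘ cong proj₂ ∷ above-zigzag p q r ≤-refl) ∷
       above-zigzag p q r (n≤1+n _) ∷
       zigzagEdges-unique p q r 1+n≢n)
  ; fresh   = subst (All _) (sym edges)
      (n≤1+n p ∷ n≤1+n p ∷ n≤1+n p ∷ ≤-refl ∷ ≤-refl ∷ zigzagEdges-high p q r ≤-refl (n≤1+n p))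
  }
  where
  x p q : ℕ
  x = 1 + r * 2
  p = suc x
  q = suc p
  p< : p < 2 + p
  p< = n≤1+n _
  q< : q < 2 + p
  q< = ≤-refl
  edges : walk 0 (q ∷ q ∷ x ∷ p ∷ p ∷ zigzag p q r) 0 ≡
          (q , 0) ∷ (q , q) ∷ (q , x) ∷ (p , x) ∷ (p , p) ∷ zigzagEdges p q r
  edges = cong ((q , 0) ∷_) (cong₂ _∷_ (edge-≥ ≤-refl) (cong₂ _∷_ (edge-≥ (<⇒≤ (n≤1+n _)))
    (cong₂ _∷_ (edge-≤ (n≤1+n x)) (cong₂ _∷_ (edge-≥ ≤-refl)
    (walk-zigzag p q r (<⇒≤ (n≤1+n _)) (<⇒≤ (<⇒≤ (n≤1+n _))))))))

-- Induction on the number of colours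

-- Counts are doubled: m is a capacity, k(k + 1) or k² in the applications, and d is the constant
-- beside 2n in the matching lower bound. The case b = 0 makes the chord a loop at colour 0.
Fits : (b d m k : ℕ) → Set
Fits b d m k = ∀ {i l} → 3 ≤ i → 3 ≤ l → d + 2 * (i + l) ≤ m → Drawing b k i l

-- The pairs out of reach of the induction: their total exceeds the old capacity m, but removing c
-- edges from the longer part would leave fewer than 3. Here k is already the new number of colours.
Gap : (b d m c k : ℕ) → Set
Gap b d m c k = ∀ {i l} → 3 ≤ i → i ≤ l → l < 3 + c →
                m < d + 2 * (i + l) → d + 2 * (i + l) ≤ m + 2 * c → Drawing b k i l

private
  total-cut : ∀ d i l c → d + 2 * (i + (l + c)) ≡ d + 2 * (i + l) + 2 * c
  total-cut = solve-∀

cut : ∀ {b d m c k i l} e → Detour k c → e + c ≤ l → d + 2 * (i + l) ≤ m + 2 * c →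
      (∀ {l′} → e ≤ l′ → d + 2 * (i + l′) ≤ m → Drawing b k i l′) → Drawing b (2 + k) i l
cut {b} {d} {m} {c} {k} {i} {l} e D e+c≤l fit smaller =
  subst (Drawing b (2 + k) i) l∸c+c≡l (extend D (smaller (m+n≤o⇒m≤o∸n e e+c≤l) fit′))
  where
  l∸c+c≡l : l ∸ c + c ≡ l
  l∸c+c≡l = m∸n+n≡m (m+n≤o⇒n≤o e e+c≤l)
  fit′ : d + 2 * (i + (l ∸ c)) ≤ m
  fit′ = +-cancelʳ-≤ (2 * c) _ m (subst (_≤ m + 2 * c)
    (trans (cong (λ z → d + 2 * (i + z)) (sym l∸c+c≡l)) (total-cut d i (l ∸ c) c)) fit)

private
  grow-ordered : ∀ {b d m c k i l} → Detour k c → Fits b d m k → Gap b d m c (2 + k) →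
                 3 ≤ i → i ≤ l → d + 2 * (i + l) ≤ m + 2 * c → Drawing b (2 + k) i l
  grow-ordered {d = d} {m} {c} {i = i} {l} D fits gap 3≤i i≤l fit with d + 2 * (i + l) ≤? m | 3 + c ≤? l
  ... | yes small | _        = widen (fits 3≤i (≤-trans 3≤i i≤l) small)
  ... | no  _     | yes long = cut {d = d} 3 D long fit (fits 3≤i)
  ... | no  large | no short = gap 3≤i i≤l (≰⇒> short) (≰⇒> large) fit

grow : ∀ {b d m c k} → Detour k c → Fits b d m k → Gap b d m c (2 + k) → Fits b d (m + 2 * c) (2 + k)
grow {d = d} {m} {c} D fits gap {i} {l} 3≤i 3≤l fit with ≤-total i l
... | inj₁ i≤l = grow-ordered {d = d} D fits gap 3≤i i≤l fit
... | inj₂ l≤i = swap (grow-ordered {d = d} D fits gap 3≤l l≤i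
                   (subst (λ z → d + 2 * z ≤ m + 2 * c) (+-comm i l) fit))

-- A first part of two edges from 0 back to 0 would repeat its edge, so here b = 1. Only the second
-- part is ever cut.
Fits₂ : (d m k : ℕ) → Set
Fits₂ d m k = ∀ {l} → 2 ≤ l → d + 2 * (2 + l) ≤ m → Drawing 1 k 2 l

Gap₂ : (d m c k : ℕ) → Set
Gap₂ d m c k = ∀ {l} → 2 ≤ l → l < 2 + c → m < d + 2 * (2 + l) → d + 2 * (2 + l) ≤ m + 2 * c → Drawing 1 k 2 l

grow₂ : ∀ {d m c k} → Detour k c → Fits₂ d m k → Gap₂ d m c (2 + k) → Fits₂ d (m + 2 * c) (2 + k)
grow₂ {d} {m} {c} D fits gap {l} 2≤l fit with d + 2 * (2 + l) ≤? m | 2 + c ≤? l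
... | yes small | _        = widen (fits 2≤l small)
... | no  _     | yes long = cut {d = d} 2 D long fit fits
... | no  large | no short = gap 2≤l (≰⇒> short) (≰⇒> large) fit

-- Tabulated drawings

Table : Set
Table = List (List ℕ × List ℕ)

-- Doubling a vertex of a walk inserts the loop there.
insertLoops : (r : ℕ) (seen : List ℕ) → List ℕ → List ℕ × ℕ × List ℕ
insertLoops zero    seen xs       = xs , 0 , seen
insertLoops (suc r) seen []       = [] , suc r , seen
insertLoops (suc r) seen (x ∷ xs) with does (_∈?_ _≟_ x seen)
... | true  = let xs′ , rest = insertLoops (suc r) seen xs in x ∷ xs′ , rest
... | false = let xs′ , rest = insertLoops r (x ∷ seen) xs in x ∷ x ∷ xs′ , rest

-- Leftover loops are put at vertex 0, so at most one of them is admissible.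
stretch : (b i l : ℕ) → List ℕ × List ℕ → List ℕ × List ℕ
stretch b i l (xs , ys) =
  let xs′ , r , seen = insertLoops (i ∸ suc (length xs)) (0 ∷ []) xs
      ys′ , s , _    = insertLoops (l ∸ suc (length ys)) seen (b ∷ ys)
  in replicate r 0 ++ xs′ , drop 1 ys′ ++ replicate s 0

Listed : (T : Table) (b k i l : ℕ) → Set
Listed T b k i l = Any (IsDrawing b k i l ∘ stretch b i l) T

listed? : ∀ T b k i l → Dec (Listed T b k i l)
listed? T b k i l = any? (isDrawing? b k i l ∘ stretch b i l) T

listed⇒drawing : ∀ {T b k i l} → Listed T b k i l → Drawing b k i l
listed⇒drawing found = let _ , drawing = satisfied found in _ , drawing

-- The bounds on l and i come first, so that the statement has the shape of nested `allUpTo?`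
-- searches.
Covers : (T : Table) (b d m c k : ℕ) → Set
Covers T b d m c k = ∀ {l} → l < 3 + c → ∀ {i} → i < suc l → 3 ≤ i →
                     m < d + 2 * (i + l) → d + 2 * (i + l) ≤ m + 2 * c → Listed T b k i l

covers? : ∀ T b d m c k → Dec (Covers T b d m c k)
covers? T b d m c k = allUpTo? (λ l → allUpTo? (λ i → 3 ≤? i →-dec m <? d + 2 * (i + l) →-dec
  d + 2 * (i + l) ≤? m + 2 * c →-dec listed? T b k i l) (suc l)) (3 + c)

tabulatedGap : ∀ T b d m c k {_ : True (covers? T b d m c k)} → Gap b d m c k
tabulatedGap T b d m c k {covers} 3≤i i≤l short large fit =
  listed⇒drawing (toWitness covers short (s≤s i≤l) 3≤i large fit)

Covers₂ : (T : Table) (d m c k : ℕ) → Set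
Covers₂ T d m c k = ∀ {l} → l < 2 + c → 2 ≤ l →
                    m < d + 2 * (2 + l) → d + 2 * (2 + l) ≤ m + 2 * c → Listed T 1 k 2 l

covers₂? : ∀ T d m c k → Dec (Covers₂ T d m c k)
covers₂? T d m c k = allUpTo? (λ l → 2 ≤? l →-dec m <? d + 2 * (2 + l) →-dec
  d + 2 * (2 + l) ≤? m + 2 * c →-dec listed? T 1 k 2 l) (2 + c)

tabulatedGap₂ : ∀ T d m c k {_ : True (covers₂? T d m c k)} → Gap₂ d m c k
tabulatedGap₂ T d m c k {covers} 2≤l short large fit = listed⇒drawing (toWitness covers short 2≤l large fit)

-- Loopless walks found by computer search, chosen so that inserting loops reaches every pair in the gaps.
closed5 : Table
closed5 =
  (4 ∷ 1 ∷ 2 ∷ [] ,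
   3 ∷ 2 ∷ 4 ∷ 3 ∷ 1 ∷ []) ∷
  (2 ∷ 1 ∷ [] ,
   4 ∷ 1 ∷ 3 ∷ []) ∷
  (4 ∷ 3 ∷ [] ,
   1 ∷ 3 ∷ 2 ∷ 4 ∷ 1 ∷ 2 ∷ []) ∷
  (3 ∷ 4 ∷ [] ,
   1 ∷ 2 ∷ []) ∷
  []

closed7 : Table
closed7 =
  (2 ∷ 5 ∷ 6 ∷ 4 ∷ 3 ∷ [] ,
   5 ∷ 3 ∷ 2 ∷ 1 ∷ 3 ∷ 6 ∷ 1 ∷ 5 ∷ 4 ∷ []) ∷
  (5 ∷ 6 ∷ 2 ∷ 3 ∷ 4 ∷ 5 ∷ 3 ∷ 1 ∷ [] ,
   2 ∷ 1 ∷ 6 ∷ 3 ∷ 0 ∷ 4 ∷ 2 ∷ 5 ∷ 1 ∷ 4 ∷ 6 ∷ []) ∷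
  (6 ∷ 2 ∷ [] ,
   1 ∷ 4 ∷ 2 ∷ 5 ∷ 3 ∷ 4 ∷ 0 ∷ 3 ∷ 1 ∷ 5 ∷ []) ∷
  (3 ∷ 6 ∷ 2 ∷ 5 ∷ [] ,
   4 ∷ 6 ∷ 5 ∷ 4 ∷ 1 ∷ 2 ∷ []) ∷
  (4 ∷ 6 ∷ 1 ∷ 4 ∷ 2 ∷ 1 ∷ [] ,
   2 ∷ 5 ∷ 3 ∷ 4 ∷ 5 ∷ 6 ∷ 0 ∷ 3 ∷ 2 ∷ 6 ∷ 3 ∷ 1 ∷ 5 ∷ []) ∷
  []

closed9 : Table
closed9 =
  (8 ∷ 7 ∷ 4 ∷ 1 ∷ 3 ∷ 7 ∷ 1 ∷ 5 ∷ 6 ∷ 4 ∷ [] ,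
   1 ∷ 6 ∷ 7 ∷ 2 ∷ 6 ∷ 8 ∷ 3 ∷ 0 ∷ 5 ∷ 3 ∷ 2 ∷ 4 ∷ 3 ∷ 6 ∷ []) ∷
  (7 ∷ 8 ∷ 4 ∷ 5 ∷ 3 ∷ 8 ∷ 2 ∷ 0 ∷ 6 ∷ 4 ∷ 1 ∷ 3 ∷ 6 ∷ 1 ∷ 8 ∷ [] ,
   4 ∷ 3 ∷ 2 ∷ 6 ∷ 5 ∷ 8 ∷ 6 ∷ 7 ∷ 4 ∷ 2 ∷ 7 ∷ 1 ∷ 2 ∷ 5 ∷ 1 ∷ []) ∷
  (7 ∷ 5 ∷ 6 ∷ 3 ∷ 7 ∷ 1 ∷ 3 ∷ 4 ∷ [] ,
   1 ∷ 2 ∷ 4 ∷ 5 ∷ 2 ∷ 7 ∷ 4 ∷ 6 ∷ 2 ∷ 8 ∷ 1 ∷ 4 ∷ 8 ∷ []) ∷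
  []

closed11 : Table
closed11 =
  (3 ∷ 7 ∷ 6 ∷ 8 ∷ 10 ∷ 0 ∷ 8 ∷ 4 ∷ 2 ∷ 6 ∷ 1 ∷ 3 ∷ 5 ∷ 9 ∷ 1 ∷ 2 ∷ 5 ∷ [] ,
   4 ∷ 3 ∷ 9 ∷ 7 ∷ 8 ∷ 3 ∷ 10 ∷ 6 ∷ 5 ∷ 8 ∷ 2 ∷ 10 ∷ 1 ∷ 7 ∷ 4 ∷ 10 ∷ 7 ∷ 5 ∷ 10 ∷ 9 ∷ []) ∷
  []

open4 : Table
open4 =
  (2 ∷ [] ,
   3 ∷ []) ∷
  []

open6 : Table
open6 =
  (5 ∷ 2 ∷ 4 ∷ [] ,
   3 ∷ 5 ∷ 4 ∷ 0 ∷ 3 ∷ 2 ∷ []) ∷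
  (4 ∷ [] ,
   2 ∷ 3 ∷ 4 ∷ 5 ∷ []) ∷
  (4 ∷ [] ,
   3 ∷ 2 ∷ 0 ∷ 5 ∷ 1 ∷ 2 ∷ 5 ∷ 4 ∷ 3 ∷ []) ∷
  (4 ∷ 5 ∷ 0 ∷ 3 ∷ 2 ∷ [] ,
   4 ∷ 3 ∷ 1 ∷ 5 ∷ 2 ∷ []) ∷
  (3 ∷ [] ,
   2 ∷ []) ∷
  (2 ∷ 3 ∷ [] ,
   5 ∷ 2 ∷ 4 ∷ []) ∷
  []

open8 : Table
open8 =
  (7 ∷ 6 ∷ 2 ∷ 1 ∷ 3 ∷ 4 ∷ [] ,
   6 ∷ 0 ∷ 4 ∷ 6 ∷ 5 ∷ 2 ∷ 4 ∷ 7 ∷ 3 ∷ 5 ∷ []) ∷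
  (7 ∷ 3 ∷ 5 ∷ 0 ∷ 2 ∷ 4 ∷ 5 ∷ 7 ∷ 2 ∷ [] ,
   7 ∷ 4 ∷ 1 ∷ 6 ∷ 5 ∷ 1 ∷ 3 ∷ 0 ∷ 4 ∷ 6 ∷ 2 ∷ 3 ∷ 6 ∷ []) ∷
  (3 ∷ 4 ∷ [] ,
   2 ∷ 6 ∷ 4 ∷ 5 ∷ 3 ∷ 1 ∷ 7 ∷ 0 ∷ 6 ∷ 3 ∷ 2 ∷ []) ∷
  (7 ∷ 3 ∷ 4 ∷ 0 ∷ 6 ∷ [] ,
   5 ∷ 6 ∷ 2 ∷ 5 ∷ 7 ∷ 4 ∷ 6 ∷ 3 ∷ []) ∷
  []

open10 : Table
open10 =
  (2 ∷ 1 ∷ 6 ∷ 2 ∷ 4 ∷ 8 ∷ 9 ∷ 2 ∷ 8 ∷ 6 ∷ 9 ∷ 3 ∷ [] ,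
   9 ∷ 5 ∷ 2 ∷ 7 ∷ 4 ∷ 1 ∷ 7 ∷ 5 ∷ 0 ∷ 6 ∷ 7 ∷ 8 ∷ 1 ∷ 5 ∷ 3 ∷ 7 ∷ []) ∷
  []

triangle5 : Table
triangle5 =
  (2 ∷ [] ,
   3 ∷ 4 ∷ 2 ∷ 3 ∷ []) ∷
  (3 ∷ [] ,
   4 ∷ []) ∷
  []

triangle7 : Table
triangle7 =
  (4 ∷ [] ,
   6 ∷ 4 ∷ 2 ∷ 0 ∷ 5 ∷ 4 ∷ 3 ∷ 1 ∷ 5 ∷ 6 ∷ []) ∷
  (3 ∷ [] ,
   2 ∷ 5 ∷ 0 ∷ 4 ∷ 1 ∷ 6 ∷ 2 ∷ 4 ∷ 5 ∷ 3 ∷ 4 ∷ 6 ∷ []) ∷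
  []

-- Closing the gaps for every number of colours

private
  -- With k = 3 + 2h, the 2k + 3 edges of a detour raise k(k + 1) to (k + 2)(k + 3).
  capacity-odd : ∀ h → (3 + h * 2) * (4 + h * 2) + 2 * (9 + h * 4) ≡ (5 + h * 2) * (6 + h * 2)
  capacity-odd = solve-∀

  -- With k = 2 + 2h, the 2k + 2 edges of a detour raise k² to (k + 2)², so the omitted edge {p, q}
  -- costs nothing.
  capacity-even : ∀ h → (2 + h * 2) * (2 + h * 2) + 2 * (6 + h * 4) ≡ (4 + h * 2) * (4 + h * 2)
  capacity-even = solve-∀

  capacity-even′ : ∀ h → (6 + h * 2) * (6 + h * 2) + 2 * (14 + h * 4) ≡ (8 + h * 2) * (8 + h * 2)
  capacity-even′ = solve-∀

  -- Even if both parts have the greatest length 2 + c in a gap, here 27 + 4h, the old capacity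
  -- suffices. By `no-gap` such a gap is empty; the other slack identities serve in the same way.
  slack-closed : ∀ h → (11 + h * 2) * (12 + h * 2) ≡
                 2 + 2 * ((27 + h * 4) + (27 + h * 4)) + (22 + 30 * h + 4 * h * h)
  slack-closed = solve-∀

  slack-open : ∀ h → (10 + h * 2) * (10 + h * 2) ≡
               0 + 2 * ((24 + h * 4) + (24 + h * 4)) + (4 + 24 * h + 4 * h * h)
  slack-open = solve-∀

  slack-odd₂ : ∀ h → (7 + h * 2) * (8 + h * 2) ≡ 6 + 2 * (2 + (18 + h * 4)) + (10 + 22 * h + 4 * h * h)
  slack-odd₂ = solve-∀

  slack-even₂ : ∀ h → (6 + h * 2) * (6 + h * 2) ≡ 0 + 2 * (2 + (15 + h * 4)) + (2 + 16 * h + 4 * h * h)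
  slack-even₂ = solve-∀

  no-gap : ∀ {b d m c k} z → m ≡ d + 2 * ((2 + c) + (2 + c)) + z → Gap b d m c k
  no-gap {d = d} z refl {i} {l} _ i≤l (s≤s l≤2+c) large _ = contradiction large (≤⇒≯
    (≤-trans (+-monoʳ-≤ d (*-monoʳ-≤ 2 (+-mono-≤ (≤-trans i≤l l≤2+c) l≤2+c))) (m≤m+n _ z)))

  no-gap₂ : ∀ {d m c k} z → m ≡ d + 2 * (2 + (1 + c)) + z → Gap₂ d m c k
  no-gap₂ {d = d} z refl _ (s≤s l≤1+c) large _ = contradiction large (≤⇒≯
    (≤-trans (+-monoʳ-≤ d (*-monoʳ-≤ 2 (+-monoʳ-≤ 2 l≤1+c))) (m≤m+n _ z)))

gap-closed : ∀ h → Gap 0 2 ((3 + h * 2) * (4 + h * 2)) (9 + h * 4) (5 + h * 2)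
gap-closed 0 = tabulatedGap closed5  0 2 12 9 5
gap-closed 1 = tabulatedGap closed7  0 2 30 13 7
gap-closed 2 = tabulatedGap closed9  0 2 56 17 9
gap-closed 3 = tabulatedGap closed11 0 2 90 21 11
gap-closed (suc (suc (suc (suc h)))) = no-gap {d = 2} _ (slack-closed h)

gap-open : ∀ h → Gap 1 0 ((2 + h * 2) * (2 + h * 2)) (6 + h * 4) (4 + h * 2)
gap-open 0 = tabulatedGap open4  1 0 4 6 4
gap-open 1 = tabulatedGap open6  1 0 16 10 6
gap-open 2 = tabulatedGap open8  1 0 36 14 8
gap-open 3 = tabulatedGap open10 1 0 64 18 10
gap-open (suc (suc (suc (suc h)))) = no-gap {d = 0} _ (slack-open h)

gap-odd₂ : ∀ h → Gap₂ 6 ((3 + h * 2) * (4 + h * 2)) (9 + h * 4) (5 + h * 2)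
gap-odd₂ 0 = tabulatedGap₂ triangle5 6 12 9 5
gap-odd₂ 1 = tabulatedGap₂ triangle7 6 30 13 7
gap-odd₂ (suc (suc h)) = no-gap₂ {d = 6} _ (slack-odd₂ h)

-- For odd k the complete graph with loops has even degrees, so with the chord as a loop at 0 every
-- edge can be used.
drawing-closed : ∀ h → Fits 0 2 ((3 + h * 2) * (4 + h * 2)) (3 + h * 2)
-- Two parts of length at least 3 need 14, while three colours offer 3 * 4 = 12.
drawing-closed zero    3≤i 3≤l fit =
  contradiction (≤-trans (+-monoʳ-≤ 2 (*-monoʳ-≤ 2 (+-mono-≤ 3≤i 3≤l))) fit) (from-no (14 ≤? 12))
drawing-closed (suc h) 3≤i 3≤l fit =
  grow {d = 2} (detour-odd (suc h)) (drawing-closed h) (gap-closed h) 3≤i 3≤l (≤-trans fit (≤-reflexive (sym (capacity-odd h))))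

-- For even k only the ends of a chord with two different colours can use all their k + 1 darts;
-- hence b = 1.
drawing-open : ∀ h → Fits 1 0 ((2 + h * 2) * (2 + h * 2)) (2 + h * 2)
drawing-open zero    3≤i 3≤l fit =
  contradiction (≤-trans (*-monoʳ-≤ 2 (+-mono-≤ 3≤i 3≤l)) fit) (from-no (12 ≤? 4))
drawing-open (suc h) 3≤i 3≤l fit =
  grow {d = 0} (detour-even h) (drawing-open h) (gap-open h) 3≤i 3≤l (≤-trans fit (≤-reflexive (sym (capacity-even h))))

-- The constant 6 is 2 for the chord plus the four darts lost in `edges≤-odd`.
drawing-odd₂ : ∀ h → Fits₂ 6 ((3 + h * 2) * (4 + h * 2)) (3 + h * 2)
drawing-odd₂ zero    2≤l fit =
  contradiction (≤-trans (+-monoʳ-≤ 6 (*-monoʳ-≤ 2 (+-monoʳ-≤ 2 2≤l))) fit) (from-no (14 ≤? 12))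
drawing-odd₂ (suc h) 2≤l fit =
  grow₂ {d = 6} (detour-odd (suc h)) (drawing-odd₂ h) (gap-odd₂ h) 2≤l (≤-trans fit (≤-reflexive (sym (capacity-odd h))))

-- The induction starts at six colours, since four colours fail for n = 8 although 2n = 16 is within
-- capacity.
drawing-even₂ : ∀ h → Fits₂ 0 ((6 + h * 2) * (6 + h * 2)) (6 + h * 2)
drawing-even₂ zero    {l} 2≤l fit =
  -- With m = 0 and c = 18 the gap is the whole range 2 * (2 + l) ≤ 36, so the table covers every l.
  tabulatedGap₂ open6 0 0 18 6 2≤l (s≤s (≤-trans (m+n≤o⇒n≤o 2 (*-cancelˡ-≤ 2 fit)) (from-yes (18 ≤? 19)))) z<s fit
drawing-even₂ (suc h) 2≤l fit =
  grow₂ {d = 0} (detour-even (2 + h)) (drawing-even₂ h) (no-gap₂ {d = 0} _ (slack-even₂ h)) 2≤l (≤-trans fit (≤-reflexive (sym (capacity-even′ h))))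

-- Four colours are claimed only up to n = 2 + l = 7, whence the capacity 2 * 7; `no-four-colouring`
-- excludes n = 8.
drawing-four₂ : ∀ {l} → 2 ≤ l → l ≤ 5 → Drawing 1 4 2 l
drawing-four₂ 2≤l l≤5 =
  tabulatedGap₂ open4 0 0 7 4 2≤l (s≤s (≤-trans l≤5 (from-yes (5 ≤? 8)))) z<s (*-monoʳ-≤ 2 (+-monoʳ-≤ 2 l≤5))

-- From drawings to cyclic colourings

-- The default 0 is the colour of vertex 0, so reading one place past the end yields the closing
-- vertex.
nth : List ℕ → ℕ → ℕ
nth []       _       = 0
nth (x ∷ xs) zero    = x
nth (x ∷ xs) (suc t) = nth xs t

nth-< : ∀ {k xs} → 0 < k → All (_< k) xs → ∀ t → nth xs t < k
nth-< 0<k []           t       = 0<k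
nth-< 0<k (x<k ∷ xs<k) zero    = x<k
nth-< 0<k (x<k ∷ xs<k) (suc t) = nth-< 0<k xs<k t

nth-length : ∀ xs → nth xs (length xs) ≡ 0
nth-length []       = refl
nth-length (x ∷ xs) = nth-length xs

nth-++ : ∀ xs y ys → nth (xs ++ y ∷ ys) (length xs) ≡ y
nth-++ []       y ys = refl
nth-++ (x ∷ xs) y ys = nth-++ xs y ys

walk-applyUpTo : ∀ a zs → walk a zs 0 ≡ applyUpTo (λ t → edge (nth (a ∷ zs) t) (nth zs t)) (suc (length zs))
walk-applyUpTo a []       = refl
walk-applyUpTo a (z ∷ zs) = cong (edge a z ∷_) (walk-applyUpTo z zs)

unique-applyUpTo⁻ : ∀ {A : Set} (f : ℕ → A) n → Unique (applyUpTo f n) →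
                    ∀ {s t} → s < n → t < n → f s ≡ f t → s ≡ t
unique-applyUpTo⁻ f (suc n) (new ∷ unique) {zero}  {zero}  _         _         eq = refl
unique-applyUpTo⁻ f (suc n) (new ∷ unique) {zero}  {suc t} _         (s≤s t<n) eq =
  contradiction eq (All.lookup new (∈-applyUpTo⁺ (f ∘ suc) t<n))
unique-applyUpTo⁻ f (suc n) (new ∷ unique) {suc s} {zero}  (s≤s s<n) _         eq =
  contradiction (sym eq) (All.lookup new (∈-applyUpTo⁺ (f ∘ suc) s<n))
unique-applyUpTo⁻ f (suc n) (new ∷ unique) {suc s} {suc t} (s≤s s<n) (s≤s t<n) eq =
  cong suc (unique-applyUpTo⁻ (f ∘ suc) n unique s<n t<n eq)

drawing⇒cyclic : ∀ {b k i l} → Drawing b k i l → CyclicColouring (i + l) i k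
drawing⇒cyclic {b} {k} ((xs , ys) , b<k , refl , refl , xs<k , ys<k , unique) = record
  { colour   = colour
  ; bounded  = nth-< 0<k (0<k ∷ All.++⁺ xs<k (b<k ∷ ys<k))
  ; closed   = trans (cong colour (sym length-zs)) (nth-length (0 ∷ zs))
  ; distinct = λ s≤n t≤n → unique-applyUpTo⁻ (label i colour) _ (subst Unique edges unique) (s≤s s≤n) (s≤s t≤n)
  }
  where
  i l : ℕ
  i = suc (length xs)
  l = suc (length ys)
  zs : List ℕ
  zs = xs ++ b ∷ ys
  colour : ℕ → ℕ
  colour = nth (0 ∷ zs)
  0<k : 0 < k
  0<k = ≤-trans z<s b<k
  length-zs : suc (length zs) ≡ i + l
  length-zs = cong suc (length-++ xs)
  edges : edge 0 b ∷ walk 0 xs b ++ walk b ys 0 ≡ applyUpTo (label i colour) (suc (i + l))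
  edges = cong₂ _∷_ (cong (edge 0) (sym (nth-++ xs b ys)))
    (trans (sym (walk-++ 0 xs b ys 0))
      (trans (walk-applyUpTo 0 zs) (cong (applyUpTo (label i colour ∘ suc)) length-zs)))

-- Cyclic colourings and colourings of the graph

edge-injective : ∀ a b c d → edge a b ≡ edge c d → SamePair a b c d
edge-injective a b c d eq with ≤-total a b | ≤-total c d
... | inj₁ a≤b | inj₁ c≤d = let e = trans (sym (edge-≤ a≤b)) (trans eq (edge-≤ c≤d)) in inj₁ (cong proj₂ e , cong proj₁ e)
... | inj₁ a≤b | inj₂ d≤c = let e = trans (sym (edge-≤ a≤b)) (trans eq (edge-≥ d≤c)) in inj₂ (cong proj₂ e , cong proj₁ e)
... | inj₂ b≤a | inj₁ c≤d = let e = trans (sym (edge-≥ b≤a)) (trans eq (edge-≤ c≤d)) in inj₂ (cong proj₁ e , cong proj₂ e)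
... | inj₂ b≤a | inj₂ d≤c = let e = trans (sym (edge-≥ b≤a)) (trans eq (edge-≥ d≤c)) in inj₁ (cong proj₁ e , cong proj₂ e)

cyclic⇒colouring : ∀ {n j k} → CyclicColouring n j k → HasEDColouring (CnChord n j) k
cyclic⇒colouring {n} {j} {k} C = c , distinguishing
  where
  open CyclicColouring C renaming (colour to g)

  c : Fin n → Fin k
  c v = fromℕ< (bounded (toℕ v))

  Oriented : Fin n → Fin n → Set
  Oriented u v = CycleStep n u v ⊎ ChordStep j u v

  orient : ∀ {u v} → CnChord n j u v → Oriented u v ⊎ Oriented v u
  orient (inj₁ s)               = inj₁ (inj₁ s)
  orient (inj₂ (inj₁ s))        = inj₂ (inj₁ s)
  orient (inj₂ (inj₂ (inj₁ s))) = inj₁ (inj₂ s)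
  orient (inj₂ (inj₂ (inj₂ s))) = inj₂ (inj₂ s)

  -- The number of the edge in the sense of `label`. Once oriented along the cycle or the chord, an
  -- edge is determined by it.
  index : ∀ {u v} → Oriented u v → ℕ
  index {u} (inj₁ _) = suc (toℕ u)
  index     (inj₂ _) = 0

  index≤n : ∀ {u v} (o : Oriented u v) → index o ≤ n
  index≤n {u} (inj₁ _) = toℕ<n u
  index≤n     (inj₂ _) = z≤n

  last : ∀ {u : Fin n} → toℕ u ≡ n ∸ 1 → suc (toℕ u) ≡ n
  last {u} eq = trans (cong suc eq) (m+[n∸m]≡n (≤-trans z<s (toℕ<n u)))

  label-index : ∀ {u v} (o : Oriented u v) → label j g (index o) ≡ edge (g (toℕ u)) (g (toℕ v))
  label-index {u} (inj₁ (inj₁ v≡1+u))        = cong (edge (g (toℕ u)) ∘ g) (sym v≡1+u)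
  label-index {u} (inj₁ (inj₂ (u-last , v≡0))) =
    cong (edge (g (toℕ u))) (trans (cong g (last u-last)) (trans closed (cong g (sym v≡0))))
  label-index     (inj₂ (u≡0 , v≡j))         = sym (cong₂ edge (cong g u≡0) (cong g v≡j))

  index-injective : ∀ {u v x y} (o : Oriented u v) (o′ : Oriented x y) → index o ≡ index o′ → u ≡ x × v ≡ y
  index-injective {u} {v} {x} {y} (inj₁ s) (inj₁ s′) eq with toℕ-injective (suc-injective eq)
  ... | refl = refl , toℕ-injective (next s s′)
    where
    next : CycleStep n u v → CycleStep n u y → toℕ v ≡ toℕ y
    next (inj₁ p)            (inj₁ q)            = trans p (sym q)
    next (inj₁ p)            (inj₂ (u-last , _)) = contradiction (trans p (last u-last)) (<⇒≢ (toℕ<n v))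
    next (inj₂ (u-last , _)) (inj₁ q)            = contradiction (trans q (last u-last)) (<⇒≢ (toℕ<n y))
    next (inj₂ (_ , p))      (inj₂ (_ , q))      = trans p (sym q)
  index-injective (inj₂ (u≡0 , v≡j)) (inj₂ (x≡0 , y≡j)) _ =
    toℕ-injective (trans u≡0 (sym x≡0)) , toℕ-injective (trans v≡j (sym y≡j))

  same : ∀ {u v x y} → Oriented u v → Oriented x y →
         edge (g (toℕ u)) (g (toℕ v)) ≡ edge (g (toℕ x)) (g (toℕ y)) → u ≡ x × v ≡ y
  same o o′ eq = index-injective o o′
    (distinct (index≤n o) (index≤n o′) (trans (label-index o) (trans eq (sym (label-index o′)))))

  colour-≡ : ∀ {u x} → c u ≡ c x → g (toℕ u) ≡ g (toℕ x)
  colour-≡ eq = trans (sym (toℕ-fromℕ< _)) (trans (cong toℕ eq) (toℕ-fromℕ< _))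

  pair⇒edge : ∀ {u v x y} → SamePair (c u) (c v) (c x) (c y) →
              edge (g (toℕ u)) (g (toℕ v)) ≡ edge (g (toℕ x)) (g (toℕ y))
  pair⇒edge (inj₁ (p , q))                 = cong₂ edge (colour-≡ p) (colour-≡ q)
  pair⇒edge {x = x} {y} (inj₂ (p , q))     = trans (cong₂ edge (colour-≡ p) (colour-≡ q)) (edge-comm (g (toℕ y)) (g (toℕ x)))

  distinguishing : IsEdgeDistinguishing (CnChord n j) c
  distinguishing u v x y uv xy pair with orient uv | orient xy
  ... | inj₁ o | inj₁ o′ = inj₁ (same o o′ (pair⇒edge pair))
  ... | inj₁ o | inj₂ o′ = inj₂ (same o o′ (trans (pair⇒edge pair) (edge-comm (g (toℕ x)) _)))
  ... | inj₂ o | inj₁ o′ = let p , q = same o o′ (trans (edge-comm (g (toℕ v)) _) (pair⇒edge pair)) in inj₂ (q , p)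
  ... | inj₂ o | inj₂ o′ = let p , q = same o o′ (trans (edge-comm (g (toℕ v)) _)
                                             (trans (pair⇒edge pair) (edge-comm (g (toℕ x)) _))) in inj₁ (q , p)

-- The colouring is read periodically modulo n. Different indices give different edges: the chord is
-- no cycle edge because 2 ≤ j ≤ n - 2, and cycle edges do not coincide because n ≥ 4.
colouring⇒cyclic : ∀ {n j k} → 2 ≤ j → 2 * j ≤ n → HasEDColouring (CnChord n j) k → CyclicColouring n j k
colouring⇒cyclic {zero}  {suc j} 2≤j ()
colouring⇒cyclic {suc m} {j} {k} 2≤j 2j≤n (c , distinguishing) = record
  { colour   = g
  ; bounded  = λ t → toℕ<n (c (vertex t))
  ; closed   = cong (toℕ ∘ c) (toℕ-injective (trans (toℕ-vertex n) (n%n≡0 n)))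
  ; distinct = distinct
  }
  where
  n : ℕ
  n = suc m

  vertex : ℕ → Fin n
  vertex t = t mod n

  g : ℕ → ℕ
  g t = toℕ (c (vertex t))

  j+2≤n : 2 + j ≤ n
  j+2≤n = ≤-trans (+-mono-≤ 2≤j (≤-reflexive (sym (+-identityʳ j)))) 2j≤n

  j<n : j < n
  j<n = <⇒≤ j+2≤n

  4≤n : 4 ≤ n
  4≤n = ≤-trans (+-monoʳ-≤ 2 2≤j) j+2≤n

  toℕ-vertex : ∀ t → toℕ (vertex t) ≡ t % n
  toℕ-vertex t = toℕ-fromℕ< (m%n<n t n)

  toℕ-vertex-< : ∀ {t} → t < n → toℕ (vertex t) ≡ t
  toℕ-vertex-< {t} t<n = trans (toℕ-vertex t) (m<n⇒m%n≡m t<n)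

  Next : ℕ → Set
  Next t = (toℕ (vertex (suc t)) ≡ suc t) ⊎ (suc t ≡ n × toℕ (vertex (suc t)) ≡ 0)

  next : ∀ {t} → t < n → Next t
  next t<n with m≤n⇒m<n∨m≡n t<n
  ... | inj₁ 1+t<n = inj₁ (toℕ-vertex-< 1+t<n)
  ... | inj₂ refl  = inj₂ (refl , trans (toℕ-vertex n) (n%n≡0 n))

  step : ∀ {t} → t < n → CycleStep n (vertex t) (vertex (suc t))
  step t<n with next t<n
  ... | inj₁ eq            = inj₁ (trans eq (cong suc (sym (toℕ-vertex-< t<n))))
  ... | inj₂ (1+t≡n , eq) = inj₂ (trans (toℕ-vertex-< t<n) (suc-injective 1+t≡n) , eq)

  chord : ChordStep j (vertex 0) (vertex j)
  chord = toℕ-vertex-< z<s , toℕ-vertex-< j<n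

  pair : ∀ {u v x y} → edge (toℕ (c u)) (toℕ (c v)) ≡ edge (toℕ (c x)) (toℕ (c y)) →
         SamePair (c u) (c v) (c x) (c y)
  pair {u} {v} {x} {y} eq with edge-injective (toℕ (c u)) (toℕ (c v)) (toℕ (c x)) (toℕ (c y)) eq
  ... | inj₁ (p , q) = inj₁ (toℕ-injective p , toℕ-injective q)
  ... | inj₂ (p , q) = inj₂ (toℕ-injective p , toℕ-injective q)

  chord≢step : ∀ {t} → t < n → label j g 0 ≢ label j g (suc t)
  chord≢step {t} t<n eq with distinguishing _ _ _ _ (inj₂ (inj₂ (inj₁ chord))) (inj₁ (step t<n)) (pair eq) | next t<n
  ... | inj₁ (p , q) | inj₁ v = contradiction
    (subst (2 ≤_) (trans (sym (toℕ-vertex-< j<n)) (trans (cong toℕ q) (trans v (cong suc (trans (sym (toℕ-vertex-< t<n)) (cong toℕ (sym p))))))) 2≤j) λ { (s≤s ()) }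
  ... | inj₁ (p , q) | inj₂ (_ , v) = contradiction
    (subst (2 ≤_) (trans (sym (toℕ-vertex-< j<n)) (trans (cong toℕ q) v)) 2≤j) λ ()
  ... | inj₂ (p , q) | inj₁ v = case trans (cong toℕ p) v of λ ()
  ... | inj₂ (p , q) | inj₂ (1+t≡n , _) = <⇒≢ j+2≤n
    (trans (cong suc (trans (sym (toℕ-vertex-< j<n)) (trans (cong toℕ q) (toℕ-vertex-< t<n)))) 1+t≡n)

  step-injective : ∀ {s t} → s < n → t < n → label j g (suc s) ≡ label j g (suc t) → s ≡ t
  step-injective {s} {t} s<n t<n eq with distinguishing _ _ _ _ (inj₁ (step s<n)) (inj₁ (step t<n)) (pair eq) | next s<n | next t<n
  ... | inj₁ (p , _) | _ | _ = trans (sym (toℕ-vertex-< s<n)) (trans (cong toℕ p) (toℕ-vertex-< t<n))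
  ... | inj₂ (p , q) | vs | vt = contradiction 4≤n (opposite vs vt)
    where
    s≡ : ∀ {w} → toℕ (vertex (suc t)) ≡ w → s ≡ w
    s≡ v = trans (sym (toℕ-vertex-< s<n)) (trans (cong toℕ p) v)
    t≡ : ∀ {w} → toℕ (vertex (suc s)) ≡ w → t ≡ w
    t≡ v = trans (sym (toℕ-vertex-< t<n)) (trans (cong toℕ (sym q)) v)
    -- Here s and t are each the successor of the other modulo n, which is possible only for n ≤ 2.
    opposite : Next s → Next t → ¬ 4 ≤ n
    opposite (inj₁ v) (inj₁ w) _ = m+1+n≢n 1 (sym (trans (s≡ w) (cong suc (t≡ v))))
    opposite (inj₁ v) (inj₂ (refl , w)) 4≤n with s≡ w
    ... | refl = contradiction (subst (λ z → 4 ≤ suc z) (t≡ v) 4≤n) λ { (s≤s (s≤s ())) }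
    opposite (inj₂ (refl , v)) (inj₁ w) 4≤n with t≡ v
    ... | refl = contradiction (subst (λ z → 4 ≤ suc z) (s≡ w) 4≤n) λ { (s≤s (s≤s ())) }
    opposite (inj₂ (refl , v)) (inj₂ (_ , w)) 4≤n = contradiction (subst (λ z → 4 ≤ suc z) (s≡ w) 4≤n) λ { (s≤s ()) }

  distinct : ∀ {s t} → s ≤ n → t ≤ n → label j g s ≡ label j g t → s ≡ t
  distinct {zero}  {zero}  _   _   _  = refl
  distinct {zero}  {suc t} _   t<n eq = contradiction eq (chord≢step t<n)
  distinct {suc s} {zero}  s<n _   eq = contradiction (sym eq) (chord≢step s<n)
  distinct {suc s} {suc t} s<n t<n eq = cong suc (step-injective s<n t<n eq)

-- Combining both bounds

moreColours : ∀ {n j k k′} → k ≤ k′ → CyclicColouring n j k → CyclicColouring n j k′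
moreColours k≤k′ C = record
  { colour = colour ; bounded = λ t → ≤-trans (bounded t) k≤k′ ; closed = closed ; distinct = distinct }
  where open CyclicColouring C

chromatic : ∀ {b n j k} → 2 ≤ j → 2 * j ≤ n → Drawing b (suc k) j (n ∸ j) → ¬ CyclicColouring n j k →
            EdgeDistChromaticNumber≡ (CnChord n j) (suc k)
chromatic {n = n} {j} {k} 2≤j 2j≤n drawing none =
  z<s ,
  cyclic⇒colouring (subst (λ m → CyclicColouring m j (suc k)) (m+[n∸m]≡n (m+n≤o⇒m≤o j 2j≤n)) (drawing⇒cyclic drawing)) ,
  λ k′ _ colouring → ≰⇒> λ k′≤k → none (moreColours k′≤k (colouring⇒cyclic 2≤j 2j≤n colouring))

-- Exhaustive search for n = 8 and j = 2

-- A walk of m further edges from u back to a on four colours, each edge new. Deciding this is a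
-- backtracking search.
Extends : (a m u : ℕ) → List (ℕ × ℕ) → Set
Extends a zero    u used = u ≡ a
Extends a (suc m) u used = ∃[ v ] (v < 4 × edge u v ∉ used × Extends a m v (edge u v ∷ used))

extends? : ∀ a m u used → Dec (Extends a m u used)
extends? a zero    u used = u ≟ a
extends? a (suc m) u used =
  anyUpTo? (λ v → ¬? (_∈?_ (≡-dec _≟_ _≟_) (edge u v) used) ×-dec extends? a m v (edge u v ∷ used)) 4

-- Here `edges≤-even` holds with equality, 18 = 16 + 2, so counting excludes nothing. The search
-- fixes the chord {a, b} and the path a, x, b, and tries all continuations by six edges.
no-extension : ∀ {a} → a < 4 → ∀ {x} → x < 4 → ∀ {b} → b < 4 →
               edge a x ∉ edge a b ∷ [] → edge x b ∉ edge a x ∷ edge a b ∷ [] →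
               ¬ Extends a 6 b (edge x b ∷ edge a x ∷ edge a b ∷ [])
no-extension = from-yes (allUpTo? (λ a → allUpTo? (λ x → allUpTo? (λ b →
  ¬? (_∈?_ (≡-dec _≟_ _≟_) (edge a x) (edge a b ∷ [])) →-dec
  ¬? (_∈?_ (≡-dec _≟_ _≟_) (edge x b) (edge a x ∷ edge a b ∷ [])) →-dec
  ¬? (extends? a 6 b (edge x b ∷ edge a x ∷ edge a b ∷ []))) 4) 4) 4)

no-four-colouring : ¬ CyclicColouring 8 2 4
no-four-colouring C = no-extension (bounded 0) (bounded 1) (bounded 2) (new {0} z<s) (new {1} (s≤s z<s))
  (extension 6 2 refl)
  where
  open CyclicColouring C renaming (colour to g)
  new : ∀ {t} → t < 8 → label 2 g (suc t) ∉ applyDownFrom (label 2 g) (suc t)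
  new {t} t<8 old with ∈-applyDownFrom⁻ (label 2 g) old
  ... | s , s<1+t , eq = <⇒≢ s<1+t (sym (distinct t<8 (≤-trans (≤-pred s<1+t) (<⇒≤ t<8)) eq))
  extension : ∀ m t → m + t ≡ 8 → Extends (g 0) m (g t) (applyDownFrom (label 2 g) (suc t))
  extension zero    t refl = closed
  extension (suc m) t eq   =
    g (suc t) , bounded (suc t) , new (subst (t <_) eq (s≤s (m≤n+m t m))) , extension m (suc t) (trans (+-suc m t) eq)

-- The two ceilings

-- When the fuel f runs out the search returns f + k unchecked, so p is assumed there.
leastFrom-spec : ∀ p k f → T (p (f + k)) →
                 T (p (leastFrom p k f)) × (∀ {i} → k ≤ i → i < leastFrom p k f → ¬ T (p i))
leastFrom-spec p k zero    holds = holds , λ k≤i i<k → contradiction k≤i (<⇒≱ i<k)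
leastFrom-spec p k (suc f) holds with p k in eq
... | true  = subst T (sym eq) _ , λ k≤i i<k → contradiction k≤i (<⇒≱ i<k)
... | false with leastFrom-spec p (suc k) f (subst (T ∘ p) (sym (+-suc f k)) holds)
...   | found , minimal = found , below
  where
  below : ∀ {i} → k ≤ i → i < leastFrom p (suc k) f → ¬ T (p i)
  below k≤i i<r with m≤n⇒m<n∨m≡n k≤i
  ... | inj₁ k<i  = minimal k<i i<r
  ... | inj₂ refl = subst T eq

module _ (m : ℕ) (f : ℕ → ℕ) (m≤fm : m ≤ f m) where

  private
    spec : let r = leastFrom (λ k → m ≤ᵇ f k) 0 m in
           T (m ≤ᵇ f r) × (∀ {i} → 0 ≤ i → i < r → ¬ T (m ≤ᵇ f i))
    spec = leastFrom-spec (λ k → m ≤ᵇ f k) 0 m (subst (λ z → T (m ≤ᵇ f z)) (sym (+-identityʳ m)) (≤⇒≤ᵇ m≤fm))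

  least-≥ : m ≤ f (leastFrom (λ k → m ≤ᵇ f k) 0 m)
  least-≥ = ≤ᵇ⇒≤ _ _ (proj₁ spec)

  least-minimal : ∀ {i} → i < leastFrom (λ k → m ≤ᵇ f k) 0 m → f i < m
  least-minimal i<r = ≰⇒> (proj₂ spec z≤n i<r ∘ ≤⇒≤ᵇ)

private
  n≤n*n : ∀ n → n ≤ n * n
  n≤n*n zero    = z≤n
  n≤n*n (suc n) = m≤m+n (suc n) (n * suc n)

  -- Turns 4d + 1 ≤ (2k + 1)², the condition defining the ceiling, into d ≤ k(k + 1), the form of
  -- the counting bounds.
  odd-square : ∀ k → (2 * k + 1) * (2 * k + 1) ≡ 4 * (k * suc k) + 1
  odd-square = solve-∀

  half-bound : ∀ m → m ≤ (2 * m + 1) * (2 * m + 1)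
  half-bound m = ≤-trans (m≤m+n m (m + 0)) (≤-trans (m≤m+n (2 * m) 1) (n≤n*n (2 * m + 1)))

ceilSqrt-≥ : ∀ m → m ≤ ceilSqrt m * ceilSqrt m
ceilSqrt-≥ m = least-≥ m (λ k → k * k) (n≤n*n m)

ceilSqrt-minimal : ∀ m {i} → i < ceilSqrt m → i * i < m
ceilSqrt-minimal m = least-minimal m (λ k → k * k) (n≤n*n m)

ceilHalf-≥ : ∀ d → let K = ceilHalfSqrtMinus1 (4 * d + 1) in d ≤ K * suc K
ceilHalf-≥ d = *-cancelˡ-≤ 4 (+-cancelʳ-≤ 1 _ _
  (subst (4 * d + 1 ≤_) (odd-square (ceilHalfSqrtMinus1 (4 * d + 1))) (least-≥ (4 * d + 1) (λ k → (2 * k + 1) * (2 * k + 1)) (half-bound _))))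

ceilHalf-minimal : ∀ d {i} → i < ceilHalfSqrtMinus1 (4 * d + 1) → i * suc i < d
ceilHalf-minimal d {i} i<K = *-cancelˡ-< 4 _ _ (+-cancelʳ-< 1 _ _
  (subst (_< 4 * d + 1) (odd-square i) (least-minimal (4 * d + 1) (λ k → (2 * k + 1) * (2 * k + 1)) (half-bound _) i<K)))

¬Odd⇒even : ∀ k → ¬ Odd k → ∃[ t ] k ≡ t * 2
¬Odd⇒even zero          _   = 0 , refl
¬Odd⇒even (suc zero)    ¬o  = contradiction (0 , refl) ¬o
¬Odd⇒even (suc (suc k)) ¬o  with ¬Odd⇒even k (λ { (t , refl) → ¬o (suc t , cong suc (cong (_+ 1) (sym (+-suc t (t + 0))))) })
... | t , refl = suc t , refl

Odd⇒1+even : ∀ {k} → Odd k → ∃[ t ] k ≡ 1 + t * 2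
Odd⇒1+even (t , refl) = t , trans (+-comm (2 * t) 1) (cong suc (*-comm 2 t))

parity-2* : ∀ h → parity (h * 2) ≡ 0ℙ
parity-2* zero    = refl
parity-2* (suc h) = parity-2* h

parity-1+2* : ∀ h → parity (1 + h * 2) ≡ 1ℙ
parity-1+2* zero    = refl
parity-1+2* (suc h) = parity-1+2* h

-- Drawings and counting bounds for the chorded cycle

module _ {n j : ℕ} (2j≤n : 2 * j ≤ n) where

  private
    j≤n : j ≤ n
    j≤n = m+n≤o⇒m≤o j 2j≤n

    j≤n∸j : j ≤ n ∸ j
    j≤n∸j = subst (_≤ n ∸ j) (trans (cong (_∸ j) (cong (j +_) (+-identityʳ j))) (m+n∸n≡m j j)) (∸-monoˡ-≤ j 2j≤n)

    split : ∀ {d m} → d + 2 * n ≤ m → d + 2 * (j + (n ∸ j)) ≤ m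
    split {d} {m} = subst (λ z → d + 2 * z ≤ m) (sym (m+[n∸m]≡n j≤n))

  module _ (3≤j : 3 ≤ j) where

    long-closed : ∀ h → 2 + 2 * n ≤ (3 + h * 2) * (4 + h * 2) → ¬ CyclicColouring n j (2 + h * 2) →
                  EdgeDistChromaticNumber≡ (CnChord n j) (3 + h * 2)
    long-closed h fit = chromatic (<⇒≤ 3≤j) 2j≤n
      (drawing-closed h 3≤j (≤-trans 3≤j j≤n∸j) (split {2} fit))

    long-open : ∀ h → 2 * n ≤ (2 + h * 2) * (2 + h * 2) → ¬ CyclicColouring n j (1 + h * 2) →
                EdgeDistChromaticNumber≡ (CnChord n j) (2 + h * 2)
    long-open h fit = chromatic (<⇒≤ 3≤j) 2j≤n
      (drawing-open h 3≤j (≤-trans 3≤j j≤n∸j) (split {0} fit))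

  module _ (j≡2 : j ≡ 2) where

    private
      2≤n∸j : 2 ≤ n ∸ j
      2≤n∸j = subst (_≤ n ∸ j) j≡2 j≤n∸j

      chromatic₂ : ∀ {k} → Drawing 1 (suc k) 2 (n ∸ j) → ¬ CyclicColouring n j k →
                   EdgeDistChromaticNumber≡ (CnChord n j) (suc k)
      chromatic₂ {k} d = chromatic (≤-reflexive (sym j≡2)) 2j≤n (subst (λ i → Drawing 1 (suc k) i (n ∸ j)) (sym j≡2) d)

      split₂ : ∀ {d m} → d + 2 * n ≤ m → d + 2 * (2 + (n ∸ j)) ≤ m
      split₂ {d} {m} fit = subst (λ i → d + 2 * (i + (n ∸ j)) ≤ m) j≡2 (split {d} fit)

    short-closed : ∀ h → 6 + 2 * n ≤ (3 + h * 2) * (4 + h * 2) → ¬ CyclicColouring n j (2 + h * 2) →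
                   EdgeDistChromaticNumber≡ (CnChord n j) (3 + h * 2)
    short-closed h fit = chromatic₂ (drawing-odd₂ h 2≤n∸j (split₂ {6} fit))

    short-open : ∀ h → 2 * n ≤ (6 + h * 2) * (6 + h * 2) → ¬ CyclicColouring n j (5 + h * 2) →
                 EdgeDistChromaticNumber≡ (CnChord n j) (6 + h * 2)
    short-open h fit = chromatic₂ (drawing-even₂ h 2≤n∸j (split₂ {0} fit))

    short-four : n ≤ 7 → ¬ CyclicColouring n j 3 → EdgeDistChromaticNumber≡ (CnChord n j) 4
    short-four n≤7 = chromatic₂ (drawing-four₂ 2≤n∸j (subst (λ i → n ∸ i ≤ 5) (sym j≡2) (∸-monoˡ-≤ 2 n≤7)))

module _ {n j k : ℕ} (C : CyclicColouring n j k) where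
  open Counting C

  colours-≥ : 2 + 2 * n ≤ k * suc k
  colours-≥ = subst (_≤ k * suc k) (*-suc 2 n) edges≤

  even-colours-≥ : parity k ≡ 0ℙ → 2 * n ≤ k * k
  even-colours-≥ pk = +-cancelʳ-≤ 2 _ _ (subst (_≤ k * k + 2) (trans (*-suc 2 n) (+-comm 2 (2 * n))) (edges≤-even pk))

  odd-colours-≥ : parity k ≡ 1ℙ → 2 ≤ n → j ≡ 2 → 6 + 2 * n ≤ k * suc k
  odd-colours-≥ pk 2≤n j≡2 =
    subst (_≤ k * suc k) (trans (+-comm (2 * suc n) 4) (cong (4 +_) (*-suc 2 n))) (edges≤-odd pk 2≤n j≡2)

-- K and S stand for the two ceilings, and 2 + d + 2 * n is twice the number of edges plus d.
module Ceilings {n d K S : ℕ}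
  (K-bound : 2 + d + 2 * n ≤ K * suc K) (K-least : ∀ {i} → i < K → i * suc i < 2 + d + 2 * n)
  (S-bound : 2 * n ≤ S * S)             (S-least : ∀ {i} → i < S → i * i < 2 * n) where

  S≤1+K : S ≤ suc K
  S≤1+K = ≮⇒≥ λ 1+K<S → <⇒≱ (S-least 1+K<S)
    (≤-trans (m≤n+m (2 * n) (2 + d)) (≤-trans K-bound (*-monoˡ-≤ (suc K) (n≤1+n K))))

  -- If S ≤ K′ = K - 1, then minimality of K gives K′(K′ + 1) < 2 + d + 2n ≤ 2 + d + K′². So S falls
  -- below K only when K is small.
  S<K⇒ : ∀ {K′} → K ≡ suc K′ → S < K → 2 * n ≤ K′ * K′ × K′ < 2 + d
  S<K⇒ {K′} refl (s≤s S≤K′) = 2n≤ , +-cancelʳ-< (K′ * K′) K′ (2 + d) (begin-strict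
    K′ + K′ * K′     ≡⟨ *-suc K′ K′ ⟨
    K′ * suc K′      <⟨ K-least ≤-refl ⟩
    2 + d + 2 * n    ≤⟨ +-monoʳ-≤ (2 + d) 2n≤ ⟩
    2 + d + K′ * K′  ∎)
    where
    open ≤-Reasoning
    2n≤ : 2 * n ≤ K′ * K′
    2n≤ = ≤-trans S-bound (*-mono-≤ S≤K′ S≤K′)

  K≤S⇒ : K ≤ S → S ≡ K ⊎ S ≡ suc K
  K≤S⇒ K≤S with m≤n⇒m<n∨m≡n K≤S
  ... | inj₁ K<S = inj₂ (≤-antisym S≤1+K K<S)
  ... | inj₂ K≡S = inj₁ (sym K≡S)

-- The formulas for j ≥ 3 and for j = 2

module Long {n j : ℕ} (3≤j : 3 ≤ j) (2j≤n : 2 * j ≤ n) (6≤n : 6 ≤ n) {K : ℕ}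
  (K-bound : 2 + 2 * n ≤ K * suc K) (K-least : ∀ {i} → i < K → i * suc i < 2 + 2 * n) where

  private
    14≤ : 14 ≤ K * suc K
    14≤ = ≤-trans (+-monoʳ-≤ 2 (*-monoʳ-≤ 2 6≤n)) K-bound

  odd : Odd K → EdgeDistChromaticNumber≡ (CnChord n j) K
  odd o with Odd⇒1+even o
  ... | zero  , refl = contradiction 14≤ (from-no (14 ≤? 2))
  ... | suc h , refl = long-closed 2j≤n 3≤j h K-bound λ C → <⇒≱ (K-least ≤-refl) (colours-≥ C)

  -- For even K, S is K or K + 1. If S = K, an open drawing exists and K - 1 colours contradict the
  -- minimality of K. If S = K + 1, the even bound excludes K colours, and the odd number K + 1
  -- leaves room for a closed drawing.
  even : ¬ Odd K → ∀ {S} → 2 * n ≤ S * S → (∀ {i} → i < S → i * i < 2 * n) →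
         EdgeDistChromaticNumber≡ (CnChord n j) S
  even ¬o {S} S-bound S-least with ¬Odd⇒even K ¬o
  ... | zero        , refl = contradiction 14≤ (from-no (14 ≤? 0))
  ... | suc zero    , refl = contradiction 14≤ (from-no (14 ≤? 6))
  ... | suc (suc h) , refl with K≤S⇒ (≮⇒≥ λ S<K → contradiction (proj₂ (S<K⇒ refl S<K)) (λ { (s≤s (s≤s ())) }))
    where open Ceilings {n} {0} {S = S} K-bound K-least S-bound S-least
  ...   | inj₁ refl = long-open 2j≤n 3≤j (suc h) S-bound λ C → <⇒≱ (K-least ≤-refl) (colours-≥ C)
  ...   | inj₂ refl = long-closed 2j≤n 3≤j (suc h) (≤-trans K-bound (*-mono-≤ (n≤1+n (4 + h * 2)) (n≤1+n (5 + h * 2))))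
                        λ C → <⇒≱ (S-least ≤-refl) (even-colours-≥ C (parity-2* h))

module Short {n j : ℕ} (j≡2 : j ≡ 2) (2j≤n : 2 * j ≤ n) (9≤n : 9 ≤ n) {K : ℕ}
  (K-bound : 6 + 2 * n ≤ K * suc K) (K-least : ∀ {i} → i < K → i * suc i < 6 + 2 * n) where

  private
    24≤ : 24 ≤ K * suc K
    24≤ = ≤-trans (+-monoʳ-≤ 6 (*-monoʳ-≤ 2 9≤n)) K-bound

    2≤n : 2 ≤ n
    2≤n = ≤-trans (s≤s (s≤s z≤n)) 9≤n

  -- The number K - 1 is even, so the even bound must exclude it: 2n ≤ (K - 1)² would give 6 + 2n ≤
  -- (K - 1)K once K - 1 ≥ 6, against the minimality of K. For K = 5 it would give 18 ≤ 16.
  odd : Odd K → EdgeDistChromaticNumber≡ (CnChord n j) K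
  odd o with Odd⇒1+even o
  ... | zero              , refl = contradiction 24≤ (from-no (24 ≤? 2))
  ... | suc zero          , refl = contradiction 24≤ (from-no (24 ≤? 12))
  ... | suc (suc zero)    , refl = short-closed 2j≤n j≡2 1 K-bound λ C →
    contradiction (≤-trans (*-monoʳ-≤ 2 9≤n) (even-colours-≥ C refl)) (from-no (18 ≤? 16))
  ... | suc (suc (suc h)) , refl = short-closed 2j≤n j≡2 (2 + h) K-bound λ C →
    <⇒≱ (K-least ≤-refl) (begin
      6 + 2 * n                              ≤⟨ +-mono-≤ (m≤m+n 6 (h * 2)) (even-colours-≥ C (parity-2* h)) ⟩
      6 + h * 2 + (6 + h * 2) * (6 + h * 2)  ≡⟨ *-suc (6 + h * 2) (6 + h * 2) ⟨
      (6 + h * 2) * (7 + h * 2)              ∎)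
    where open ≤-Reasoning

  even : ¬ Odd K → ∀ {S} → 2 * n ≤ S * S → (∀ {i} → i < S → i * i < 2 * n) →
         EdgeDistChromaticNumber≡ (CnChord n j) S
  even ¬o {S} S-bound S-least with ¬Odd⇒even K ¬o
  ... | zero              , refl = contradiction 24≤ (from-no (24 ≤? 0))
  ... | suc zero          , refl = contradiction 24≤ (from-no (24 ≤? 6))
  ... | suc (suc zero)    , refl = contradiction 24≤ (from-no (24 ≤? 20))
  ... | suc (suc (suc h)) , refl with K≤S⇒ (≮⇒≥ (S≮K h K-least S<K⇒))
    where
    open Ceilings {n} {4} {S = S} K-bound K-least S-bound S-least
    S≮K : ∀ h → (∀ {i} → i < 6 + h * 2 → i * suc i < 6 + 2 * n) →
          (∀ {K′} → 6 + h * 2 ≡ suc K′ → S < 6 + h * 2 → 2 * n ≤ K′ * K′ × K′ < 6) → ¬ S < 6 + h * 2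
    -- For K = 6 and S ≤ 5, 2n ≤ 25 forces n ≤ 12 and thus 6 + 2n ≤ 30, while minimality of K gives
    -- 30 < 6 + 2n.
    S≮K zero    least small S<K = contradiction
      (≤-trans (least ≤-refl) (+-monoʳ-≤ 6 (*-monoʳ-≤ 2 (≤-pred (*-cancelˡ-< 2 n 13 (s≤s (proj₁ (small refl S<K))))))))
      (from-no (31 ≤? 30))
    S≮K (suc h) least small S<K = contradiction (proj₂ (small refl S<K)) (≤⇒≯ (m≤m+n 6 (1 + h * 2)))
  ...   | inj₁ refl = short-open 2j≤n j≡2 h S-bound λ C →
                        <⇒≱ (K-least ≤-refl) (odd-colours-≥ C (parity-1+2* h) 2≤n j≡2)
  ...   | inj₂ refl = short-closed 2j≤n j≡2 (2 + h) (≤-trans K-bound (*-mono-≤ (n≤1+n (6 + h * 2)) (n≤1+n (7 + h * 2))))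
                        λ C → <⇒≱ (S-least ≤-refl) (even-colours-≥ C (parity-2* h))

theorem4p2 : (n j : ℕ) → 2 ≤ j → 2 * j ≤ n →
    ((j ≡ 2 → suc n ≤ 8 → EdgeDistChromaticNumber≡ (CnChord n j) 4)
    × (j ≡ 2 → suc n ≡ 9 → EdgeDistChromaticNumber≡ (CnChord n j) 5)
    × (j ≡ 2 → 10 ≤ suc n → Odd (ceilHalfSqrtMinus1 (8 * suc n + 17)) →
    EdgeDistChromaticNumber≡ (CnChord n j) (ceilHalfSqrtMinus1 (8 * suc n + 17)))
    × (j ≡ 2 → 10 ≤ suc n → ¬ Odd (ceilHalfSqrtMinus1 (8 * suc n + 17)) →
    EdgeDistChromaticNumber≡ (CnChord n j) (ceilSqrt (2 * suc n ∸ 2))))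
    × ((3 ≤ j → suc n ≤ 6 → EdgeDistChromaticNumber≡ (CnChord n j) 4)
    × (3 ≤ j → 7 ≤ suc n → Odd (ceilHalfSqrtMinus1 (8 * suc n + 1)) →
    EdgeDistChromaticNumber≡ (CnChord n j) (ceilHalfSqrtMinus1 (8 * suc n + 1)))
    × (3 ≤ j → 7 ≤ suc n → ¬ Odd (ceilHalfSqrtMinus1 (8 * suc n + 1)) →
    EdgeDistChromaticNumber≡ (CnChord n j) (ceilSqrt (2 * suc n ∸ 2))))
theorem4p2 n j 2≤j 2j≤n =
  -- Three colours fail by the odd bound: n ≥ 4 makes 6 + 2n at least 14, against 3 * 4 = 12.
  ( (λ j≡2 e≤8 → short-four 2j≤n j≡2 (≤-pred e≤8) λ C →
       contradiction (≤-trans (+-monoʳ-≤ 6 (*-monoʳ-≤ 2 4≤n)) (odd-colours-≥ C refl 2≤n j≡2)) (from-no (14 ≤? 12)))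
  , (λ { refl refl → short-closed 2j≤n refl 1 (from-yes (22 ≤? 30)) no-four-colouring })
  , (λ j≡2 10≤e → Short.odd j≡2 2j≤n (≤-pred 10≤e) (K-bound e≡₂) (K-least e≡₂))
  , (λ j≡2 10≤e ¬o → Short.even j≡2 2j≤n (≤-pred 10≤e) (K-bound e≡₂) (K-least e≡₂) ¬o S-bound S-least) )
  -- This case is empty, since j ≥ 3 forces n ≥ 6 and hence e ≥ 7.
  , (λ 3≤j e≤6 → contradiction (≤-trans (s≤s (6≤n 3≤j)) e≤6) (from-no (7 ≤? 6)))
  , (λ 3≤j _ → Long.odd 3≤j 2j≤n (6≤n 3≤j) (K-bound e≡₀) (K-least e≡₀))
  , (λ 3≤j _ ¬o → Long.even 3≤j 2j≤n (6≤n 3≤j) (K-bound e≡₀) (K-least e≡₀) ¬o S-bound S-least)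
  where
  4≤n : 4 ≤ n
  4≤n = ≤-trans (*-monoʳ-≤ 2 2≤j) 2j≤n

  2≤n : 2 ≤ n
  2≤n = ≤-trans (s≤s (s≤s z≤n)) 4≤n

  6≤n : 3 ≤ j → 6 ≤ n
  6≤n 3≤j = ≤-trans (*-monoʳ-≤ 2 3≤j) 2j≤n

  e≡₀ : 8 * suc n + 1 ≡ 4 * (2 + 2 * n) + 1
  e≡₀ = identity n
    where
    identity : ∀ n → 8 * suc n + 1 ≡ 4 * (2 + 2 * n) + 1
    identity = solve-∀

  e≡₂ : 8 * suc n + 17 ≡ 4 * (6 + 2 * n) + 1
  e≡₂ = identity n
    where
    identity : ∀ n → 8 * suc n + 17 ≡ 4 * (6 + 2 * n) + 1
    identity = solve-∀

  K-bound : ∀ {m d} → m ≡ 4 * d + 1 → d ≤ ceilHalfSqrtMinus1 m * suc (ceilHalfSqrtMinus1 m)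
  K-bound {d = d} refl = ceilHalf-≥ d

  K-least : ∀ {m d} → m ≡ 4 * d + 1 → ∀ {i} → i < ceilHalfSqrtMinus1 m → i * suc i < d
  K-least {d = d} refl = ceilHalf-minimal d

  2n≡ : 2 * suc n ∸ 2 ≡ 2 * n
  2n≡ = cong (_∸ 2) (*-suc 2 n)

  S-bound : 2 * n ≤ ceilSqrt (2 * suc n ∸ 2) * ceilSqrt (2 * suc n ∸ 2)
  S-bound = subst (_≤ ceilSqrt (2 * suc n ∸ 2) * ceilSqrt (2 * suc n ∸ 2)) 2n≡ (ceilSqrt-≥ (2 * suc n ∸ 2))

  S-least : ∀ {i} → i < ceilSqrt (2 * suc n ∸ 2) → i * i < 2 * n
  S-least {i} i<S = subst (i * i <_) 2n≡ (ceilSqrt-minimal (2 * suc n ∸ 2) i<S)
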